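{- Let $g:\mathbb{N}\to\mathbb{N}$ be a function of subpolynomial growth, and let $\{\nu_n=\lambda^{(n)}/\mu^{(n)}\}$ be a sequence of connected skew shapes with $|\nu_n|=n$ which has subpolynomial depth shape associated with $g$. Then $$\log e(\nu_n)=n\log n-\Theta\bigl(n\log g(n)\bigr)\qquad\text{as } n\to\infty.$$
   Context: $e(\lambda/\mu)$ is the number of standard Young tableaux of skew shape $\lambda/\mu$; $\log$ is the natural logarithm. A function $g:\mathbb{N}\to\mathbb{N}$ has subpolynomial growth if $1\le g(n)\le n$, $g(n)\to\infty$ and $\log g(n)=o(\log n)$ as $n\to\infty$. For a skew shape $\lambda/\mu$ define $\mathrm{width}(\lambda/\mu)=\min\{\lambda_1,\lambda'_1\}$ and $\mathrm{depth}(\lambda/\mu)=\max_{u\in\lambda/\mu}h(u)$, where $\lambda'$ is the conjugate partition and $h(u)=\lambda_i-i+\lambda'_j-j+1$ is the hook-length in $\lambda$ of the cell $u=(i,j)$. The sequence $\{\nu_n\}$ has subpolynomial depth shape associated with $g$ if $$\mathrm{width}(\nu_n)=\Theta\!\left(\frac{n}{g(n)}\right)\quad\text{and}\quad\mathrm{depth}(\nu_n)=\Theta\bigl(g(n)\bigr).$$ -}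

module Defs where

open import Data.Fin as Fin using (Fin; finToFun)
import Data.Fin.Properties as Fin
open import Data.Integer as ℤ using (+_)
import Data.Integer.Properties as ℤ
open import Data.List using (List; []; _∷_; length; filter; map; foldr; lookup; upTo; allFin; cartesianProduct)
open import Data.List.Relation.Unary.All using (All)
open import Data.List.Relation.Unary.Linked using (Linked)
open import Data.Nat as ℕ using (ℕ; zero; suc; _≤_; _<_; _≥_; _⊓_; _⊔_; _∸_)
import Data.Nat.Properties as ℕ
open import Data.Product using (_×_; _,_; ∃)
open import Data.Rational as ℚ using (ℚ; 0ℚ; 1ℚ; ½; mkℚ; _/_)
import Data.Rational.Properties as ℚ
import Data.Rational.Solver as ℚ
import Data.Rational.Unnormalised as ℚᵘ
import Data.Rational.Unnormalised.Properties as ℚᵘ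
open import Data.Sum using (_⊎_; inj₁; inj₂)
open import Relation.Binary.Construct.Closure.Equivalence using (EqClosure)
open import Relation.Binary.PropositionalEquality
open import Relation.Nullary using (Dec; _×-dec_; _⊎-dec_; _→-dec_)

IsCauchy : (ℕ → ℚ) → Set
IsCauchy x = ∀ ε → 0ℚ ℚ.< ε →
  ∃ λ N → ∀ m n → N ≤ m → N ≤ n → ℚ.∣ x m ℚ.- x n ∣ ℚ.≤ ε

record ℝ : Set where
  constructor mkℝ
  field
    seq    : ℕ → ℚ
    cauchy : IsCauchy seq

open ℝ public

infix 4 _≤ᵣ_ _≃ᵣ_

_≤ᵣ_ : ℝ → ℝ → Set
x ≤ᵣ y = ∀ ε → 0ℚ ℚ.< ε → ∃ λ N → ∀ n → N ≤ n → seq x n ℚ.≤ seq y n ℚ.+ ε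

_≃ᵣ_ : ℝ → ℝ → Set
x ≃ᵣ y = x ≤ᵣ y × y ≤ᵣ x

open ℚ.+-*-Solver using (solve; _:+_; _:-_; :-_; _:*_; _:=_; con)

private
  half+half : ∀ ε → ½ ℚ.* ε ℚ.+ ½ ℚ.* ε ≡ ε
  half+half = solve 1 (λ ε → con ½ :* ε :+ con ½ :* ε := ε) refl

  half-pos : ∀ ε → 0ℚ ℚ.< ε → 0ℚ ℚ.< ½ ℚ.* ε
  half-pos ε 0<ε = ℚ.positive⁻¹ (½ ℚ.* ε) {{ℚ.pos*pos⇒pos ½ ε {{ℚ.positive 0<ε}}}}

fromℚ : ℚ → ℝ
fromℚ q = mkℝ (λ _ → q) λ ε 0<ε → 0 , λ _ _ _ _ →
  ℚ.≤-trans (ℚ.≤-reflexive (cong ℚ.∣_∣ (ℚ.+-inverseʳ q))) (ℚ.<⇒≤ 0<ε)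

fromℕ : ℕ → ℝ
fromℕ n = fromℚ (+ n / 1)

infixl 6 _-ᵣ_

_-ᵣ_ : ℝ → ℝ → ℝ
x -ᵣ y = mkℝ (λ n → seq x n ℚ.- seq y n) λ ε 0<ε →
  let (M , p) = cauchy x (½ ℚ.* ε) (half-pos ε 0<ε)
      (N , q) = cauchy y (½ ℚ.* ε) (half-pos ε 0<ε)
  in M ⊔ N , λ m n M⊔N≤m M⊔N≤n → begin
    ℚ.∣ (seq x m ℚ.- seq y m) ℚ.- (seq x n ℚ.- seq y n) ∣
      ≡⟨ cong ℚ.∣_∣ (solve 4 (λ a b c d → (a :- b) :- (c :- d) := (a :- c) :- (b :- d))
           refl (seq x m) (seq y m) (seq x n) (seq y n)) ⟩
    ℚ.∣ (seq x m ℚ.- seq x n) ℚ.- (seq y m ℚ.- seq y n) ∣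
      ≤⟨ ℚ.∣p-q∣≤∣p∣+∣q∣ (seq x m ℚ.- seq x n) (seq y m ℚ.- seq y n) ⟩
    ℚ.∣ seq x m ℚ.- seq x n ∣ ℚ.+ ℚ.∣ seq y m ℚ.- seq y n ∣
      ≤⟨ ℚ.+-mono-≤
           (p m n (ℕ.m⊔n≤o⇒m≤o M N M⊔N≤m) (ℕ.m⊔n≤o⇒m≤o M N M⊔N≤n))
           (q m n (ℕ.m⊔n≤o⇒n≤o M N M⊔N≤m) (ℕ.m⊔n≤o⇒n≤o M N M⊔N≤n)) ⟩
    ½ ℚ.* ε ℚ.+ ½ ℚ.* ε
      ≡⟨ half+half ε ⟩
    ε ∎
  where open ℚ.≤-Reasoning

infixr 7 _·_

_·_ : ℚ → ℝ → ℝ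
q · x = mkℝ (λ n → q ℚ.* seq x n) λ ε 0<ε →
  let instance
        ε-pos : ℚ.Positive ε
        ε-pos = ℚ.positive 0<ε
      δ = ε ℚ.* r
      instance
        δ-pos : ℚ.Positive δ
        δ-pos = ℚ.pos*pos⇒pos ε r
        δ-nonNeg : ℚ.NonNegative δ
        δ-nonNeg = ℚ.pos⇒nonNeg δ
      (N , p) = cauchy x δ (ℚ.positive⁻¹ δ)
  in N , λ m n N≤m N≤n → begin
    ℚ.∣ q ℚ.* seq x m ℚ.- q ℚ.* seq x n ∣
      ≡⟨ cong ℚ.∣_∣ (solve 3 (λ q a b → q :* a :- q :* b := q :* (a :- b))
           refl q (seq x m) (seq x n)) ⟩
    ℚ.∣ q ℚ.* (seq x m ℚ.- seq x n) ∣
      ≡⟨ ℚ.∣p*q∣≡∣p∣*∣q∣ q (seq x m ℚ.- seq x n) ⟩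
    ℚ.∣ q ∣ ℚ.* ℚ.∣ seq x m ℚ.- seq x n ∣
      ≤⟨ ℚ.*-monoˡ-≤-nonNeg ℚ.∣ q ∣ {{ℚ.∣-∣-nonNeg q}} (p m n N≤m N≤n) ⟩
    ℚ.∣ q ∣ ℚ.* δ
      ≤⟨ ℚ.*-monoʳ-≤-nonNeg δ (ℚ.<⇒≤ ∣q∣<b) ⟩
    b ℚ.* δ
      ≡⟨ solve 3 (λ b ε r → b :* (ε :* r) := (b :* r) :* ε) refl b ε r ⟩
    (b ℚ.* r) ℚ.* ε
      ≡⟨ cong (ℚ._* ε) (ℚ.*-inverseʳ b) ⟩
    1ℚ ℚ.* ε
      ≡⟨ ℚ.*-identityˡ ε ⟩
    ε ∎
  where
  open ℚ.≤-Reasoning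
  b : ℚ
  b = ℚ.∣ q ∣ ℚ.+ 1ℚ
  ∣q∣<b : ℚ.∣ q ∣ ℚ.< b
  ∣q∣<b = begin-strict
    ℚ.∣ q ∣           ≡⟨ ℚ.+-identityʳ ℚ.∣ q ∣ ⟨
    ℚ.∣ q ∣ ℚ.+ 0ℚ    <⟨ ℚ.+-monoʳ-< ℚ.∣ q ∣ (ℚ.positive⁻¹ 1ℚ) ⟩
    b ∎
  instance
    b-pos : ℚ.Positive b
    b-pos = ℚ.positive (ℚ.≤-<-trans (ℚ.0≤∣p∣ q) ∣q∣<b)
    b-nonZero : ℚ.NonZero b
    b-nonZero = ℚ.pos⇒nonZero b
  r : ℚ
  r = ℚ.1/ b
  instance
    r-pos : ℚ.Positive r
    r-pos = ℚ.1/pos⇒pos b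

H : ℕ → ℚ
H zero    = 0ℚ
H (suc n) = H n ℚ.+ (+ 1 / suc n)

-- With K = suc k, the right Riemann sum of mesh 1/K for the integral
-- of dt/t over 1 ≤ t ≤ m is the sum of 1/i over K < i ≤ m K.

logSum : ℕ → ℕ → ℚ
logSum m k = H (m ℕ.* suc k) ℚ.- H (suc k)

module LogSum where
  ι : ℕ → ℚ
  ι n = + n / 1

  recip : ℕ → ℚ
  recip n = + 1 / suc n

  toℚᵘ-/ : ∀ n d → ℚ.toℚᵘ (+ n / suc d) ℚᵘ.≃ ℚᵘ.mkℚᵘ (+ n) d
  toℚᵘ-/ n d = ℚ.toℚᵘ-fromℚᵘ (ℚᵘ.mkℚᵘ (+ n) d)

  recip-anti : ∀ {m n} → m ≤ n → recip n ℚ.≤ recip m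
  recip-anti {m} {n} m≤n = ℚ.toℚᵘ-cancel-≤ (begin
    ℚ.toℚᵘ (recip n)    ≃⟨ toℚᵘ-/ 1 n ⟩
    ℚᵘ.mkℚᵘ (+ 1) n     ≤⟨ ℚᵘ.*≤* (ℤ.*-monoˡ-≤-nonNeg (+ 1) (ℤ.+≤+ (ℕ.s≤s m≤n))) ⟩
    ℚᵘ.mkℚᵘ (+ 1) m     ≃⟨ toℚᵘ-/ 1 m ⟨
    ℚ.toℚᵘ (recip m)    ∎)
    where open ℚᵘ.≤-Reasoning

  ι-suc : ∀ l → ι (suc l) ≡ 1ℚ ℚ.+ ι l
  ι-suc l = ℚ.toℚᵘ-injective (begin
    ℚ.toℚᵘ (ι (suc l))                ≈⟨ toℚᵘ-/ (suc l) 0 ⟩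
    ℚᵘ.mkℚᵘ (+ suc l) 0               ≈⟨ ℚᵘ.*≡* (cong (ℤ._* + 1) (cong +_ (cong suc (sym (ℕ.*-identityʳ l))))) ⟩
    ℚᵘ.mkℚᵘ (+ suc (l ℕ.* 1)) 0       ≈⟨ ℚᵘ.*≡* (cong (ℤ._* + 1) (cong (λ z → + 1 ℤ.+ z) (ℤ.pos-* l 1))) ⟩
    ℚᵘ.1ℚᵘ ℚᵘ.+ ℚᵘ.mkℚᵘ (+ l) 0       ≈⟨ ℚᵘ.+-congʳ ℚᵘ.1ℚᵘ (toℚᵘ-/ l 0) ⟨
    ℚᵘ.1ℚᵘ ℚᵘ.+ ℚ.toℚᵘ (ι l)          ≈⟨ ℚ.toℚᵘ-homo-+ 1ℚ (ι l) ⟨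
    ℚ.toℚᵘ (1ℚ ℚ.+ ι l)               ∎)
    where open import Relation.Binary.Reasoning.Setoid ℚᵘ.≃-setoid

  ι*recip : ∀ j i → ι (suc j) ℚ.* recip (j ℕ.+ i ℕ.* suc j) ≡ recip i
  ι*recip j i = ℚ.toℚᵘ-injective (begin
    ℚ.toℚᵘ (ι (suc j) ℚ.* recip c)
      ≈⟨ ℚ.toℚᵘ-homo-* (ι (suc j)) (recip c) ⟩
    ℚ.toℚᵘ (ι (suc j)) ℚᵘ.* ℚ.toℚᵘ (recip c)
      ≈⟨ ℚᵘ.*-cong (toℚᵘ-/ (suc j) 0) (toℚᵘ-/ 1 c) ⟩
    ℚᵘ.mkℚᵘ (+ suc j) 0 ℚᵘ.* ℚᵘ.mkℚᵘ (+ 1) c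
      ≈⟨ ℚᵘ.*≡* (cong +_ eq) ⟩
    ℚᵘ.mkℚᵘ (+ 1) i
      ≈⟨ toℚᵘ-/ 1 i ⟨
    ℚ.toℚᵘ (recip i) ∎)
    where
    open import Relation.Binary.Reasoning.Setoid ℚᵘ.≃-setoid
    c = j ℕ.+ i ℕ.* suc j
    eq : suc j ℕ.* 1 ℕ.* suc i ≡ 1 ℕ.* (1 ℕ.* suc c)
    eq = trans (cong (ℕ._* suc i) (ℕ.*-identityʳ (suc j)))
         (trans (ℕ.*-comm (suc j) (suc i))
         (sym (trans (ℕ.*-identityˡ (1 ℕ.* suc c)) (ℕ.*-identityˡ (suc c)))))

  step : ∀ a l c → a ℚ.+ ι (suc l) ℚ.* c ≡ (a ℚ.+ ι l ℚ.* c) ℚ.+ c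
  step a l c = trans (cong (λ z → a ℚ.+ z ℚ.* c) (ι-suc l))
    (solve 3 (λ a i c → a :+ (con 1ℚ :+ i) :* c := (a :+ i :* c) :+ c) refl a (ι l) c)

  zero-step : ∀ b c → H (b ℕ.+ 0) ≡ H b ℚ.+ ι 0 ℚ.* c
  zero-step b c = trans (cong H (ℕ.+-identityʳ b))
    (solve 2 (λ h c → h := h :+ con 0ℚ :* c) refl (H b) c)

  H-lower : ∀ b l c → b ℕ.+ l ≤ suc c → H b ℚ.+ ι l ℚ.* recip c ℚ.≤ H (b ℕ.+ l)
  H-lower b zero    c _ = ℚ.≤-reflexive (sym (zero-step b (recip c)))
  H-lower b (suc l) c b+1+l≤1+c = subst (λ z → H b ℚ.+ ι (suc l) ℚ.* recip c ℚ.≤ H z) (sym (ℕ.+-suc b l)) (begin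
    H b ℚ.+ ι (suc l) ℚ.* recip c             ≡⟨ step (H b) l (recip c) ⟩
    (H b ℚ.+ ι l ℚ.* recip c) ℚ.+ recip c
      ≤⟨ ℚ.+-mono-≤ (H-lower b l c (ℕ.≤-trans (ℕ.n≤1+n _) h)) (recip-anti (ℕ.s≤s⁻¹ h)) ⟩
    H (b ℕ.+ l) ℚ.+ recip (b ℕ.+ l)           ∎)
    where
    open ℚ.≤-Reasoning
    h : suc (b ℕ.+ l) ≤ suc c
    h = subst (_≤ suc c) (ℕ.+-suc b l) b+1+l≤1+c

  H-upper : ∀ b l c → c ≤ b → H (b ℕ.+ l) ℚ.≤ H b ℚ.+ ι l ℚ.* recip c
  H-upper b zero    c _ = ℚ.≤-reflexive (zero-step b (recip c))
  H-upper b (suc l) c h = subst (λ z → H z ℚ.≤ H b ℚ.+ ι (suc l) ℚ.* recip c) (sym (ℕ.+-suc b l)) (begin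
    H (b ℕ.+ l) ℚ.+ recip (b ℕ.+ l)
      ≤⟨ ℚ.+-mono-≤ (H-upper b l c h) (recip-anti (ℕ.≤-trans h (ℕ.m≤m+n b l))) ⟩
    (H b ℚ.+ ι l ℚ.* recip c) ℚ.+ recip c     ≡⟨ step (H b) l (recip c) ⟨
    H b ℚ.+ ι (suc l) ℚ.* recip c             ∎)
    where open ℚ.≤-Reasoning

  block-lower : ∀ j i → H (i ℕ.* suc j) ℚ.+ recip i ℚ.≤ H (suc i ℕ.* suc j)
  block-lower j i = subst₂ ℚ._≤_
    (cong (H (i ℕ.* suc j) ℚ.+_) (ι*recip j i))
    (cong H (ℕ.+-comm (i ℕ.* suc j) (suc j)))
    (H-lower (i ℕ.* suc j) (suc j) (j ℕ.+ i ℕ.* suc j)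
      (ℕ.≤-reflexive (ℕ.+-comm (i ℕ.* suc j) (suc j))))

  block-upper : ∀ j i → H (suc (suc i) ℕ.* suc j) ℚ.≤ H (suc i ℕ.* suc j) ℚ.+ recip i
  block-upper j i = subst₂ ℚ._≤_
    (cong H (ℕ.+-comm (suc i ℕ.* suc j) (suc j)))
    (cong (H (suc i ℕ.* suc j) ℚ.+_) (ι*recip j i))
    (H-upper (suc i ℕ.* suc j) (suc j) (j ℕ.+ i ℕ.* suc j) (ℕ.n≤1+n _))

  RefineLower : ℕ → ℕ → ℕ → Set
  RefineLower j k a =
    H (suc a) ℚ.+ H (suc k ℕ.* suc j) ℚ.≤ H (suc a ℕ.* suc j) ℚ.+ H (suc k)

  refine-lower : ∀ j k l → RefineLower j k (k ℕ.+ l)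
  refine-lower j k zero    = subst (RefineLower j k) (sym (ℕ.+-identityʳ k))
    (ℚ.≤-reflexive (ℚ.+-comm (H (suc k)) (H (suc k ℕ.* suc j))))
  refine-lower j k (suc l) = subst (RefineLower j k) (sym (ℕ.+-suc k l)) (begin
    (H A ℚ.+ recip A) ℚ.+ H (suc k ℕ.* suc j)
      ≡⟨ solve 3 (λ a r b → (a :+ r) :+ b := (a :+ b) :+ r) refl (H A) (recip A) (H (suc k ℕ.* suc j)) ⟩
    (H A ℚ.+ H (suc k ℕ.* suc j)) ℚ.+ recip A
      ≤⟨ ℚ.+-monoˡ-≤ (recip A) (refine-lower j k l) ⟩
    (H (A ℕ.* suc j) ℚ.+ H (suc k)) ℚ.+ recip A
      ≡⟨ solve 3 (λ a r b → (a :+ b) :+ r := (a :+ r) :+ b) refl (H (A ℕ.* suc j)) (recip A) (H (suc k)) ⟩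
    (H (A ℕ.* suc j) ℚ.+ recip A) ℚ.+ H (suc k)
      ≤⟨ ℚ.+-monoˡ-≤ (H (suc k)) (block-lower j A) ⟩
    H (suc A ℕ.* suc j) ℚ.+ H (suc k) ∎)
    where
    open ℚ.≤-Reasoning
    A = suc (k ℕ.+ l)

  RefineUpper : ℕ → ℕ → ℕ → Set
  RefineUpper j k a =
    (H (suc a ℕ.* suc j) ℚ.+ H (suc k)) ℚ.+ recip a
      ℚ.≤ (H (suc a) ℚ.+ H (suc k ℕ.* suc j)) ℚ.+ recip k

  refine-upper : ∀ j k l → RefineUpper j k (k ℕ.+ l)
  refine-upper j k zero    = subst (RefineUpper j k) (sym (ℕ.+-identityʳ k))
    (ℚ.≤-reflexive (cong (ℚ._+ recip k) (ℚ.+-comm (H (suc k ℕ.* suc j)) (H (suc k)))))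
  refine-upper j k (suc l) = subst (RefineUpper j k) (sym (ℕ.+-suc k l)) (begin
    (H (suc A ℕ.* suc j) ℚ.+ H (suc k)) ℚ.+ recip A
      ≤⟨ ℚ.+-monoˡ-≤ (recip A) (ℚ.+-monoˡ-≤ (H (suc k)) (block-upper j (k ℕ.+ l))) ⟩
    ((H (A ℕ.* suc j) ℚ.+ recip (k ℕ.+ l)) ℚ.+ H (suc k)) ℚ.+ recip A
      ≡⟨ solve 4 (λ a r b s → ((a :+ r) :+ b) :+ s := ((a :+ b) :+ r) :+ s) refl
           (H (A ℕ.* suc j)) (recip (k ℕ.+ l)) (H (suc k)) (recip A) ⟩
    ((H (A ℕ.* suc j) ℚ.+ H (suc k)) ℚ.+ recip (k ℕ.+ l)) ℚ.+ recip A
      ≤⟨ ℚ.+-monoˡ-≤ (recip A) (refine-upper j k l) ⟩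
    ((H A ℚ.+ H (suc k ℕ.* suc j)) ℚ.+ recip k) ℚ.+ recip A
      ≡⟨ solve 4 (λ a b r s → ((a :+ b) :+ r) :+ s := ((a :+ s) :+ b) :+ r) refl
           (H A) (H (suc k ℕ.* suc j)) (recip k) (recip A) ⟩
    ((H A ℚ.+ recip A) ℚ.+ H (suc k ℕ.* suc j)) ℚ.+ recip k ∎)
    where
    open ℚ.≤-Reasoning
    A = suc (k ℕ.+ l)

  recip-nonNeg : ∀ n → 0ℚ ℚ.≤ recip n
  recip-nonNeg n = ℚ.toℚᵘ-cancel-≤
    (ℚᵘ.≤-trans (ℚᵘ.nonNegative⁻¹ (ℚᵘ.mkℚᵘ (+ 1) n)) (ℚᵘ.≤-reflexive (ℚᵘ.≃-sym (toℚᵘ-/ 1 n))))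

  shift : ∀ a b c d r → a ℚ.+ b ℚ.≤ (c ℚ.+ d) ℚ.+ r → a ℚ.- d ℚ.≤ (c ℚ.- b) ℚ.+ r
  shift a b c d r h = subst₂ ℚ._≤_
    (solve 3 (λ a b d → (a :+ b) :- (b :+ d) := a :- d) refl a b d)
    (solve 4 (λ b c d r → ((c :+ d) :+ r) :- (b :+ d) := (c :- b) :+ r) refl b c d r)
    (ℚ.+-monoˡ-≤ (ℚ.- (b ℚ.+ d)) h)

  -- the sum at mesh 1/(K J), compared with the one at mesh 1/K
  fine : ℕ → ℕ → ℕ → ℚ
  fine m j k = H (suc m ℕ.* suc k ℕ.* suc j) ℚ.- H (suc k ℕ.* suc j)

  fine-lower : ∀ m j k → logSum (suc m) k ℚ.≤ fine m j k
  fine-lower m j k = subst (logSum (suc m) k ℚ.≤_) (ℚ.+-identityʳ (fine m j k))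
    (shift mK KJ mKJ K 0ℚ
      (ℚ.≤-trans (refine-lower j k (m ℕ.* suc k))
                 (ℚ.≤-reflexive (sym (ℚ.+-identityʳ (mKJ ℚ.+ K))))))
    where
    mK = H (suc m ℕ.* suc k)
    KJ = H (suc k ℕ.* suc j)
    mKJ = H (suc m ℕ.* suc k ℕ.* suc j)
    K = H (suc k)

  fine-upper : ∀ m j k → fine m j k ℚ.≤ logSum (suc m) k ℚ.+ recip k
  fine-upper m j k = shift mKJ K mK KJ (recip k) (begin
    mKJ ℚ.+ K                  ≡⟨ ℚ.+-identityʳ (mKJ ℚ.+ K) ⟨
    (mKJ ℚ.+ K) ℚ.+ 0ℚ         ≤⟨ ℚ.+-monoʳ-≤ (mKJ ℚ.+ K) (recip-nonNeg (k ℕ.+ m ℕ.* suc k)) ⟩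
    (mKJ ℚ.+ K) ℚ.+ recip (k ℕ.+ m ℕ.* suc k)
                               ≤⟨ refine-upper j k (m ℕ.* suc k) ⟩
    (mK ℚ.+ KJ) ℚ.+ recip k    ∎)
    where
    open ℚ.≤-Reasoning
    mK = H (suc m ℕ.* suc k)
    KJ = H (suc k ℕ.* suc j)
    mKJ = H (suc m ℕ.* suc k ℕ.* suc j)
    K = H (suc k)

  fine-comm : ∀ m j k → fine m j k ≡ fine m k j
  fine-comm m j k = cong₂ ℚ._-_
    (cong H (trans (ℕ.*-assoc (suc m) (suc k) (suc j))
            (trans (cong (suc m ℕ.*_) (ℕ.*-comm (suc k) (suc j)))
                   (sym (ℕ.*-assoc (suc m) (suc j) (suc k))))))
    (cong H (ℕ.*-comm (suc k) (suc j)))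

  logSum-close : ∀ m j k → logSum (suc m) k ℚ.- logSum (suc m) j ℚ.≤ recip j
  logSum-close m j k = subst (logSum (suc m) k ℚ.- logSum (suc m) j ℚ.≤_)
    (solve 2 (λ a r → (a :+ r) :- a := r) refl (logSum (suc m) j) (recip j))
    (ℚ.+-monoˡ-≤ (ℚ.- logSum (suc m) j)
      (ℚ.≤-trans (fine-lower m j k)
      (ℚ.≤-trans (ℚ.≤-reflexive (fine-comm m j k)) (fine-upper m k j))))

  archimedean : ∀ ε → 0ℚ ℚ.< ε → ∃ λ N → recip N ℚ.≤ ε
  archimedean ε@(mkℚ ℤ.+[1+ p ] d _) _ = d , ℚ.toℚᵘ-cancel-≤
    (ℚᵘ.≤-trans (ℚᵘ.≤-reflexive (toℚᵘ-/ 1 d))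
      (ℚᵘ.*≤* (ℤ.*-monoʳ-≤-nonNeg (+ suc d) {+ 1} {+ suc p} (ℤ.+≤+ (ℕ.s≤s ℕ.z≤n)))))
  archimedean (mkℚ (+ zero) d _)     (ℚ.*<* (ℤ.+<+ ()))
  archimedean (mkℚ ℤ.-[1+ p ] d _)   (ℚ.*<* ())

  abs-≤ : ∀ p q ε → p ℚ.- q ℚ.≤ ε → q ℚ.- p ℚ.≤ ε → ℚ.∣ p ℚ.- q ∣ ℚ.≤ ε
  abs-≤ p q ε h₁ h₂ with ℚ.∣p∣≡p∨∣p∣≡-p (p ℚ.- q)
  ... | inj₁ eq = subst (ℚ._≤ ε) (sym eq) h₁
  ... | inj₂ eq = subst (ℚ._≤ ε)
    (sym (trans eq (solve 2 (λ p q → :- (p :- q) := q :- p) refl p q))) h₂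

  logSum-cauchy : ∀ m → IsCauchy (logSum (suc m))
  logSum-cauchy m ε 0<ε =
    let (N , h) = archimedean ε 0<ε
    in N , λ j k N≤j N≤k → abs-≤ (logSum (suc m) j) (logSum (suc m) k) ε
      (ℚ.≤-trans (logSum-close m k j) (ℚ.≤-trans (recip-anti N≤k) h))
      (ℚ.≤-trans (logSum-close m j k) (ℚ.≤-trans (recip-anti N≤j) h))

-- The value at 0 is a placeholder.

log : ℕ → ℝ
log zero    = fromℕ 0
log (suc m) = mkℝ (logSum (suc m)) (LogSum.logSum-cauchy m)

-- Asymptotics as n → ∞, for sequences that are eventually nonnegative.
-- Rational constants suffice, every positive real being bounded above
-- and below by positive rationals.

infix 4 _∈Θ_ _∈o_

_∈Θ_ : (ℕ → ℝ) → (ℕ → ℝ) → Set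
f ∈Θ h = ∃ λ c → ∃ λ C → 0ℚ ℚ.< c × 0ℚ ℚ.< C ×
  ∃ λ N → ∀ n → N ≤ n → c · h n ≤ᵣ f n × f n ≤ᵣ C · h n

_∈o_ : (ℕ → ℝ) → (ℕ → ℝ) → Set
f ∈o h = ∀ ε → 0ℚ ℚ.< ε → ∃ λ N → ∀ n → N ≤ n → f n ≤ᵣ ε · h n

record SubpolynomialGrowth (g : ℕ → ℕ) : Set where
  field
    bounds    : ∀ n → 1 ≤ n → 1 ≤ g n × g n ≤ n
    unbounded : ∀ M → ∃ λ N → ∀ n → N ≤ n → M ≤ g n
    subpoly   : (λ n → log (g n)) ∈o log

-- Rows and columns are indexed from 0 below.

record Partition : Set where
  field
    parts      : List ℕ
    decreasing : Linked _≥_ parts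
    positive   : All (0 <_) parts

open Partition public

nth : List ℕ → ℕ → ℕ
nth []       _       = 0
nth (x ∷ xs) zero    = x
nth (x ∷ xs) (suc i) = nth xs i

row : Partition → ℕ → ℕ
row p = nth (parts p)

-- column lengths, i.e. the parts of the conjugate partition
col : Partition → ℕ → ℕ
col p j = length (filter (j ℕ.<?_) (parts p))

record SkewShape : Set where
  field
    outer inner : Partition
    inner⊆outer : ∀ i → row inner i ≤ row outer i

open SkewShape public

Cell : Set
Cell = ℕ × ℕ

_∈ˢ_ : Cell → SkewShape → Set
(i , j) ∈ˢ ν = row (inner ν) i ≤ j × j < row (outer ν) i

_∈ˢ?_ : ∀ u ν → Dec (u ∈ˢ ν)
(i , j) ∈ˢ? ν = (row (inner ν) i ℕ.≤? j) ×-dec (j ℕ.<? row (outer ν) i)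

cells : SkewShape → List Cell
cells ν = filter (_∈ˢ? ν) (cartesianProduct (upTo (col (outer ν) 0)) (upTo (row (outer ν) 0)))

size : SkewShape → ℕ
size ν = length (cells ν)

-- (i , j) here is the cell (i + 1, j + 1) in 1-based coordinates, so
-- the hook length is λᵢ₊₁ - (i+1) + λ'ⱼ₊₁ - (j+1) + 1.
hook : Partition → Cell → ℕ
hook p (i , j) = (row p i ℕ.+ col p j) ∸ (i ℕ.+ j ℕ.+ 1)

width : SkewShape → ℕ
width ν = row (outer ν) 0 ⊓ col (outer ν) 0

depth : SkewShape → ℕ
depth ν = foldr _⊔_ 0 (map (hook (outer ν)) (cells ν))

data EastOrSouth : Cell → Cell → Set where
  east  : ∀ {i j} → EastOrSouth (i , j) (i , suc j)
  south : ∀ {i j} → EastOrSouth (i , j) (suc i , j)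

Step : SkewShape → Cell → Cell → Set
Step ν u v = u ∈ˢ ν × v ∈ˢ ν × EastOrSouth u v

Connected : SkewShape → Set
Connected ν = ∀ u v → u ∈ˢ ν → v ∈ˢ ν → EqClosure (Step ν) u v

_◁_ : Cell → Cell → Set
(i , j) ◁ (i′ , j′) = (i ≡ i′ × j < j′) ⊎ (j ≡ j′ × i < i′)

_◁?_ : ∀ u v → Dec (u ◁ v)
(i , j) ◁? (i′ , j′) = ((i ℕ.≟ i′) ×-dec (j ℕ.<? j′)) ⊎-dec ((j ℕ.≟ j′) ×-dec (i ℕ.<? i′))

-- A filling assigns an entry to each position in the list of cells. The
-- entries are 0, …, n-1 in place of 1, …, n, where n is the number of
-- cells, so an injective filling uses each entry exactly once.

Filling : SkewShape → Set
Filling ν = Fin (size ν) → Fin (size ν)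

IsSYT : ∀ ν → Filling ν → Set
IsSYT ν T = (∀ a b → T a ≡ T b → a ≡ b)
          × (∀ a b → lookup (cells ν) a ◁ lookup (cells ν) b → T a Fin.< T b)

isSYT? : ∀ ν (T : Filling ν) → Dec (IsSYT ν T)
isSYT? ν T =
  Fin.all? (λ a → Fin.all? λ b → (T a Fin.≟ T b) →-dec (a Fin.≟ b))
  ×-dec Fin.all? (λ a → Fin.all? λ b →
       (lookup (cells ν) a ◁? lookup (cells ν) b) →-dec (T a Fin.<? T b))

-- finToFun enumerates the n ^ n fillings, each exactly once.

e : SkewShape → ℕ
e ν = length (filter (λ k → isSYT? ν (finToFun k)) (allFin (size ν ℕ.^ size ν)))

-- the quotient, with a placeholder value at denominator 0
quot : ℕ → ℕ → ℚ
quot n zero    = 0ℚ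
quot n (suc d) = + n / suc d

record SubpolynomialDepth (g : ℕ → ℕ) (ν : ℕ → SkewShape) : Set where
  field
    width-Θ : (λ n → fromℕ (width (ν n))) ∈Θ (λ n → fromℚ (quot n (g n)))
    depth-Θ : (λ n → fromℕ (depth (ν n))) ∈Θ (λ n → fromℕ (g n))

{-# OPTIONS --safe #-}

-- The counts satisfy n! / (depth + 1)ⁿ ≤ e ≤ widthⁿ. For the upper bound,
-- say that the width is the number of rows: a tableau is determined by the
-- word whose k-th letter is the row of the entry k. For the lower bound, the
-- hook length is at most the depth and strictly decreases along rows and
-- columns, so sorting a permutation of the cells stably by decreasing hook
-- length gives a standard filling; this filling and the word of hook lengths
-- in the order of the permutation determine the permutation. Since
-- n! ≥ (n/4)ⁿ, width = O(n/g), depth = O(g) and g → ∞, eventually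
-- e² gⁿ ≤ n²ⁿ and nⁿ ≤ e g²ⁿ; take logarithms.

module Submission where

open import Defs
open LogSum using (ι; recip; ι-suc; ι*recip; toℚᵘ-/; recip-nonNeg; recip-anti; logSum-close; archimedean)
open import Data.Fin as Fin using (Fin; zero; suc; finToFun; funToFin; combine; remQuot; punchIn; punchOut; toℕ; fromℕ<)
import Data.Fin.Properties as Fin
open import Data.Integer as ℤ using (+_)
import Data.Integer.Properties as ℤ
open import Data.List using (List; []; _∷_; length; filter; foldr; lookup; allFin; upTo; cartesianProduct)
open import Data.List.Membership.Propositional using (_∈_)
open import Data.List.Membership.Propositional.Properties using (∈-filter⁺; ∈-filter⁻; ∈-lookup; ∈-allFin; ∈-map⁺; ∈-cartesianProduct⁻; ∈-upTo⁻)
open import Data.List.Properties using (filter-accept; filter-notAll; length-tabulate)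
import Data.List.Relation.Unary.All as All
open import Data.List.Relation.Unary.AllPairs using (_∷_)
open import Data.List.Relation.Unary.Any as Any using (here; there; index)
open import Data.List.Relation.Unary.Any.Properties using (lookup-index)
open import Data.List.Relation.Unary.Linked as Linked using (Linked; []; [-]; _∷_)
open import Data.List.Relation.Unary.Unique.Propositional using (Unique)
import Data.List.Relation.Unary.Unique.Propositional.Properties as Unique
open import Data.Nat as ℕ using (ℕ; zero; suc; _+_; _*_; _∸_; _^_; _!; _⊔_; _≤_; _<_; _≥_; z≤n; s≤s; NonZero)
open import Data.Nat.Induction using (<-rec)
import Data.Nat.Properties as ℕ
import Data.Nat.Solver as ℕ
open import Data.Product using (_×_; _,_; ∃; proj₁; proj₂)
open import Data.Rational as ℚ using (ℚ; 0ℚ; 1ℚ; ½; mkℚ; _/_)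
import Data.Rational.Properties as ℚ
import Data.Rational.Solver as ℚ
import Data.Rational.Unnormalised as ℚᵘ
import Data.Rational.Unnormalised.Properties as ℚᵘ
open import Data.Sum using (_⊎_; inj₁; inj₂)
open import Function using (_∘_)
open import Relation.Binary.Definitions using (tri<; tri≈; tri>)
open import Relation.Binary.PropositionalEquality
open import Relation.Nullary using (Dec; yes; no; ¬_; contradiction)
open import Relation.Unary using (Decidable)

-- Counting functions between finite sets through their codes.

lookup-injective : ∀ {A : Set} {xs : List A} → Unique xs →
  ∀ i j → lookup xs i ≡ lookup xs j → i ≡ j
lookup-injective (x∉ ∷ u) zero    zero    _  = refl
lookup-injective (x∉ ∷ u) zero    (suc j) eq = contradiction eq (All.lookup x∉ (∈-lookup j))
lookup-injective (x∉ ∷ u) (suc i) zero    eq = contradiction (sym eq) (All.lookup x∉ (∈-lookup i))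
lookup-injective (x∉ ∷ u) (suc i) (suc j) eq = cong suc (lookup-injective u i j eq)

funToFin-cong : ∀ {m n} {f g : Fin m → Fin n} → f ≗ g → funToFin f ≡ funToFin g
funToFin-cong {zero}  f≗g = refl
funToFin-cong {suc m} f≗g = cong₂ combine (f≗g zero) (funToFin-cong (f≗g ∘ suc))

funToFin-injective : ∀ {m n} (f g : Fin m → Fin n) → funToFin f ≡ funToFin g → f ≗ g
funToFin-injective f g eq i = begin
  f i                         ≡⟨ Fin.finToFun-funToFin f i ⟨
  finToFun (funToFin f) i     ≡⟨ cong (λ k → finToFun k i) eq ⟩
  finToFun (funToFin g) i     ≡⟨ Fin.finToFun-funToFin g i ⟩
  g i                         ∎
  where open ≡-Reasoning

finToFun-injective : ∀ {m n} (k l : Fin (n ^ m)) → finToFun {n} {m} k ≗ finToFun l → k ≡ l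
finToFun-injective {m} {n} k l eq = begin
  k                                  ≡⟨ Fin.funToFin-finToFin {m} k ⟨
  funToFin (finToFun {n} {m} k)      ≡⟨ funToFin-cong eq ⟩
  funToFin (finToFun {n} {m} l)      ≡⟨ Fin.funToFin-finToFin {m} l ⟩
  l                                  ∎
  where open ≡-Reasoning

-- `count` repeats the shape of the definition of `e`, so at `isSYT? ν` it is `e ν` by computation.
-- Functions are compared pointwise throughout, since only their codes can be equated.
module FunctionCount {n m : ℕ} {P : (Fin n → Fin m) → Set} (P? : ∀ f → Dec (P f)) where

  private
    good : List (Fin (m ^ n))
    good = filter (λ k → P? (finToFun k)) (allFin (m ^ n))

  count : ℕ
  count = length good

  count-≤ : ∀ {N} (enc : ∀ f → P f → Fin N) →
    (∀ f g p q → enc f p ≡ enc g q → f ≗ g) → count ≤ N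
  count-≤ enc enc-inj = Fin.injective⇒≤ {f = λ i → enc (finToFun (lookup good i)) (holds i)} λ {i} {j} eq →
    lookup-injective (Unique.filter⁺ (λ k → P? (finToFun k)) (Unique.allFin⁺ (m ^ n))) i j
      (finToFun-injective (lookup good i) (lookup good j) (enc-inj _ _ _ _ eq))
    where
    holds : ∀ i → P (finToFun (lookup good i))
    holds i = proj₂ (∈-filter⁻ (λ k → P? (finToFun k)) {xs = allFin (m ^ n)} (∈-lookup i))

  -- `dec` may identify indices, provided that `tag` separates those that it identifies: then the
  -- position of `dec i` in `good`, paired with `tag i`, is an injective code of `i`. Extensionality
  -- of `P` is what carries it from `dec i` to the decoded function that the filter tests.
  ≤-count* : ∀ {M K} (dec : Fin M → Fin n → Fin m) (tag : Fin M → Fin K) →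
    (∀ {f g} → f ≗ g → P f → P g) → (∀ i → P (dec i)) →
    (∀ i j → dec i ≗ dec j → tag i ≡ tag j → i ≡ j) → M ≤ count * K
  ≤-count* dec tag extensional holds inj = Fin.injective⇒≤ {f = λ i → combine (index (found i)) (tag i)} λ {i} {j} eq →
    let (eq₁ , eq₂) = Fin.combine-injective (index (found i)) (tag i) (index (found j)) (tag j) eq
    in inj i j
      (funToFin-injective (dec i) (dec j)
        (trans (lookup-index (found i)) (trans (cong (lookup good) eq₁) (sym (lookup-index (found j))))))
      eq₂
    where
    found : ∀ i → funToFin (dec i) ∈ good
    found i = ∈-filter⁺ (λ k → P? (finToFun k)) (∈-allFin _)
      (extensional (λ a → sym (Fin.finToFun-funToFin (dec i) a)) (holds i))

-- Injections of a finite set into itself, and Lehmer codes.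

Injective′ : ∀ {m n} → (Fin m → Fin n) → Set
Injective′ f = ∀ a b → f a ≡ f b → a ≡ b

-- Pigeonhole: if `k` were missed, punching it out would inject `Fin (suc n)` into `Fin n`.
injective⇒surjective : ∀ {n} (f : Fin n → Fin n) → Injective′ f → ∀ k → ∃ λ a → f a ≡ k
injective⇒surjective {suc n} f f-inj k with Fin.any? (λ a → f a Fin.≟ k)
... | yes found = found
... | no missed = contradiction
  (Fin.injective⇒≤ {f = λ a → punchOut (avoids a)} (λ {a} {b} eq → f-inj a b (Fin.punchOut-injective (avoids a) (avoids b) eq)))
  ℕ.1+n≰n
  where
  avoids : ∀ a → k ≢ f a
  avoids a k≡fa = missed (a , sym k≡fa)

module Inverse {n} (f : Fin n → Fin n) (f-inj : Injective′ f) where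

  inv : Fin n → Fin n
  inv k = proj₁ (injective⇒surjective f f-inj k)

  f∘inv : ∀ k → f (inv k) ≡ k
  f∘inv k = proj₂ (injective⇒surjective f f-inj k)

  inv∘f : ∀ a → inv (f a) ≡ a
  inv∘f a = f-inj _ _ (f∘inv (f a))

  inv-injective : Injective′ inv
  inv-injective k l eq = trans (sym (f∘inv k)) (trans (cong f eq) (f∘inv l))

Fin-strong-induction : ∀ {n} (P : Fin n → Set) →
  (∀ k → (∀ l → l Fin.< k → P l) → P k) → ∀ k → P k
Fin-strong-induction P step k = <-rec (λ x → ∀ k → toℕ k ≡ x → P k)
  (λ x ih k k≡x → step k (λ l l<k → ih (subst (toℕ l <_) k≡x l<k) l refl)) (toℕ k) k refl

-- the permutation with Lehmer code c
perm : ∀ n → Fin (n !) → Fin n → Fin n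
perm (suc n) c zero    = proj₁ (remQuot {suc n} (n !) c)
perm (suc n) c (suc a) = punchIn (proj₁ (remQuot {suc n} (n !) c)) (perm n (proj₂ (remQuot {suc n} (n !) c)) a)

perm-injective : ∀ n c → Injective′ (perm n c)
perm-injective (suc n) c zero    zero    _  = refl
perm-injective (suc n) c zero    (suc b) eq = contradiction (sym eq) (Fin.punchInᵢ≢i _ _)
perm-injective (suc n) c (suc a) zero    eq = contradiction eq (Fin.punchInᵢ≢i _ _)
perm-injective (suc n) c (suc a) (suc b) eq =
  cong suc (perm-injective n _ a b (Fin.punchIn-injective _ _ _ eq))

-- The value at `zero` is the leading digit; once these agree, the common `punchIn` cancels and
-- leaves the permutations of the remaining codes.
perm-code-injective : ∀ n c d → perm n c ≗ perm n d → c ≡ d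
perm-code-injective zero    zero zero _  = refl
perm-code-injective (suc n) c    d    eq = begin
  c                  ≡⟨ Fin.combine-remQuot {suc n} (n !) c ⟨
  combine i₁ c₁      ≡⟨ cong₂ combine (eq zero) (perm-code-injective n c₁ d₁ tails) ⟩
  combine i₂ d₁      ≡⟨ Fin.combine-remQuot {suc n} (n !) d ⟩
  d                  ∎
  where
  open ≡-Reasoning
  i₁ = proj₁ (remQuot {suc n} (n !) c)
  i₂ = proj₁ (remQuot {suc n} (n !) d)
  c₁ = proj₂ (remQuot {suc n} (n !) c)
  d₁ = proj₂ (remQuot {suc n} (n !) d)
  tails : perm n c₁ ≗ perm n d₁
  tails a = Fin.punchIn-injective i₁ _ _
    (trans (eq (suc a)) (cong (λ i → punchIn i (perm n d₁ a)) (sym (eq zero))))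

-- Lengths of filtered lists, and sorting by a key.

module _ {A : Set} {P Q : A → Set} (P? : Decidable P) (Q? : Decidable Q) (P⇒Q : ∀ x → P x → Q x) where

  length-filter-mono : ∀ xs → length (filter P? xs) ≤ length (filter Q? xs)
  length-filter-mono []       = z≤n
  length-filter-mono (x ∷ xs) with P? x | Q? x
  ... | yes p | yes q = s≤s (length-filter-mono xs)
  ... | yes p | no ¬q = contradiction (P⇒Q x p) ¬q
  ... | no ¬p | yes q = ℕ.m≤n⇒m≤1+n (length-filter-mono xs)
  ... | no ¬p | no ¬q = length-filter-mono xs

  length-filter-strict : ∀ {a xs} → ¬ P a → Q a → a ∈ xs → length (filter P? xs) < length (filter Q? xs)
  length-filter-strict {a} ¬pa qa (here {xs = xs} refl) with P? a | Q? a
  ... | yes p | _     = contradiction p ¬pa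
  ... | no _  | yes q = s≤s (length-filter-mono xs)
  ... | no _  | no ¬q = contradiction qa ¬q
  length-filter-strict ¬pa qa (there {x = x} a∈xs) with P? x | Q? x
  ... | yes p | yes q = s≤s (length-filter-strict ¬pa qa a∈xs)
  ... | yes p | no ¬q = contradiction (P⇒Q x p) ¬q
  ... | no ¬p | yes q = ℕ.m≤n⇒m≤1+n (length-filter-strict ¬pa qa a∈xs)
  ... | no ¬p | no ¬q = length-filter-strict ¬pa qa a∈xs

-- The rank counts the indices of smaller key. This is less than `n` because `a` is never below its
-- own key. For injective keys the rank is the permutation that sorts by `κ`.
module Rank {n} (κ : Fin n → ℕ) where

  private
    below? : ∀ x → Decidable (λ b → κ b < x)
    below? x b = κ b ℕ.<? x

    below : ℕ → List (Fin n) → ℕ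
    below x = length ∘ filter (below? x)

    below-< : ∀ a → below (κ a) (allFin n) < n
    below-< a = subst (below (κ a) (allFin n) <_) (length-tabulate {n = n} (λ i → i))
      (filter-notAll (below? (κ a)) (allFin n) (Any.map (λ { refl → ℕ.<-irrefl refl }) (∈-allFin a)))

  rank : Fin n → Fin n
  rank a = fromℕ< (below-< a)

  rank-mono : ∀ a b → κ a < κ b → rank a Fin.< rank b
  rank-mono a b κa<κb = subst₂ _<_ (sym (Fin.toℕ-fromℕ< (below-< a))) (sym (Fin.toℕ-fromℕ< (below-< b)))
    (length-filter-strict (below? (κ a)) (below? (κ b)) (λ _ κc<κa → ℕ.<-trans κc<κa κa<κb)
      (ℕ.<-irrefl refl) κa<κb (∈-allFin a))

  rank-cancel : (∀ a b → κ a ≡ κ b → a ≡ b) → ∀ a b → rank a Fin.< rank b → κ a < κ b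
  rank-cancel κ-inj a b ra<rb with ℕ.<-cmp (κ a) (κ b)
  ... | tri< p _ _ = p
  ... | tri≈ _ p _ = contradiction (cong (toℕ ∘ rank) (κ-inj a b p)) (ℕ.<⇒≢ ra<rb)
  ... | tri> _ _ p = contradiction (rank-mono b a p) (ℕ.<-asym ra<rb)

  rank-injective : (∀ a b → κ a ≡ κ b → a ≡ b) → Injective′ rank
  rank-injective κ-inj a b eq with ℕ.<-cmp (κ a) (κ b)
  ... | tri< p _ _ = contradiction (cong toℕ eq) (ℕ.<⇒≢ (rank-mono a b p))
  ... | tri≈ _ p _ = κ-inj a b p
  ... | tri> _ _ p = contradiction (cong toℕ (sym eq)) (ℕ.<⇒≢ (rank-mono b a p))

-- Upper and lower bounds for the number of linear extensions.

module LinearExtension {n} {_≺_ : Fin n → Fin n → Set}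
  (lin? : ∀ (T : Fin n → Fin n) → Dec (Injective′ T × (∀ a b → a ≺ b → T a Fin.< T b))) where

  open FunctionCount lin?

  module _ {w} (chain : Fin n → Fin w)
    (comparable : ∀ a b → chain a ≡ chain b → a ≡ b ⊎ a ≺ b ⊎ b ≺ a) where

    -- Strong induction on the entry `k`: suppose S and T have the same word and place all smaller
    -- entries alike. The places of `k` in S and in T lie on one chain. If they differ, say with
    -- that of S first, then T puts there an entry below `k`, which by induction S puts there too,
    -- although S has `k` there.
    count≤w^n : count ≤ w ^ n
    count≤w^n = count-≤ (λ T T-lin → funToFin (chain ∘ Inverse.inv T (proj₁ T-lin))) injective
      where
      injective : ∀ S T S-lin T-lin →
        funToFin (chain ∘ Inverse.inv S (proj₁ S-lin)) ≡ funToFin (chain ∘ Inverse.inv T (proj₁ T-lin)) → S ≗ T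
      injective S T (S-inj , S-mono) (T-inj , T-mono) eq a =
        trans (sym (T.f∘inv (S a))) (cong T (trans (sym (inverses-agree (S a))) (S.inv∘f a)))
        where
        module S = Inverse S S-inj
        module T = Inverse T T-inj
        same-chain : ∀ k → chain (S.inv k) ≡ chain (T.inv k)
        same-chain = funToFin-injective _ _ eq

        inverses-agree : ∀ k → S.inv k ≡ T.inv k
        inverses-agree = Fin-strong-induction _ λ k ih →
          case-split k ih (comparable (S.inv k) (T.inv k) (same-chain k))
          where
          case-split : ∀ k → (∀ l → l Fin.< k → S.inv l ≡ T.inv l) →
            S.inv k ≡ T.inv k ⊎ S.inv k ≺ T.inv k ⊎ T.inv k ≺ S.inv k → S.inv k ≡ T.inv k
          case-split k ih (inj₁ eq) = eq
          case-split k ih (inj₂ (inj₁ s≺t)) = contradiction (cong toℕ l≡k) (ℕ.<⇒≢ l<k)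
            where
            l = T (S.inv k)
            l<k : l Fin.< k
            l<k = subst (l Fin.<_) (T.f∘inv k) (T-mono _ _ s≺t)
            l≡k : l ≡ k
            l≡k = S.inv-injective l k (trans (ih l l<k) (T.inv∘f (S.inv k)))
          case-split k ih (inj₂ (inj₂ t≺s)) = contradiction (cong toℕ l≡k) (ℕ.<⇒≢ l<k)
            where
            l = S (T.inv k)
            l<k : l Fin.< k
            l<k = subst (l Fin.<_) (S.f∘inv k) (S-mono _ _ t≺s)
            l≡k : l ≡ k
            l≡k = T.inv-injective l k (trans (sym (ih l l<k)) (S.inv∘f (T.inv k)))

  module _ {D} (level : Fin n → Fin D)
    (level-mono : ∀ a b → a ≺ b → level a Fin.< level b) where

    private
      -- `combine` is lexicographic: the level decides and the permutation breaks ties, so ranking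
      -- by the key is the stable sort by level.
      key : Fin (n !) → Fin n → ℕ
      key c a = toℕ (combine (level a) (perm n c a))

      key-injective : ∀ c a b → key c a ≡ key c b → a ≡ b
      key-injective c a b eq = perm-injective n c a b
        (Fin.combine-injectiveʳ (level a) _ (level b) _ (Fin.toℕ-injective eq))

      module R c = Rank (key c)
      module P c = Inverse (perm n c) (perm-injective n c)

      word : Fin (n !) → Fin (D ^ n)
      word c = funToFin (level ∘ P.inv c)

      linear : ∀ c → Injective′ (R.rank c) × (∀ a b → a ≺ b → R.rank c a Fin.< R.rank c b)
      linear c = R.rank-injective c (key-injective c)
        , λ a b a≺b → R.rank-mono c a b (Fin.combine-monoˡ-< _ _ (level-mono a b a≺b))

      key-mono : ∀ c {a b} → level a ≡ level b → perm n c a Fin.< perm n c b → key c a < key c b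
      key-mono c {a} {b} la≡lb σa<σb = subst₂ _<_
        (sym (Fin.toℕ-combine (level a) (perm n c a)))
        (sym (trans (Fin.toℕ-combine (level b) (perm n c b)) (cong (λ l → n * toℕ l + toℕ (perm n c b)) (sym la≡lb))))
        (ℕ.+-monoʳ-< (n * toℕ (level a)) σa<σb)

      key-cancel : ∀ c {a b} → level a ≡ level b → key c a < key c b → perm n c a Fin.< perm n c b
      key-cancel c {a} {b} la≡lb κa<κb = ℕ.+-cancelˡ-< (n * toℕ (level a)) _ _ (subst₂ _<_
        (Fin.toℕ-combine (level a) (perm n c a))
        (trans (Fin.toℕ-combine (level b) (perm n c b)) (cong (λ l → n * toℕ l + toℕ (perm n c b)) (sym la≡lb)))
        κa<κb)

      module _ (c d : Fin (n !)) (ranks-agree : R.rank c ≗ R.rank d) (words-agree : word c ≡ word d) where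

        -- Within one level keys compare as permutation values do, and the ranking remembers how
        -- keys compare. So equal rankings make both permutations order each level alike.
        transfer : ∀ {a b} → level a ≡ level b → perm n c a Fin.< perm n c b → perm n d a Fin.< perm n d b
        transfer {a} {b} la≡lb σa<σb = key-cancel d la≡lb
          (R.rank-cancel d (key-injective d) a b
            (subst₂ Fin._<_ (ranks-agree a) (ranks-agree b) (R.rank-mono c a b (key-mono c la≡lb σa<σb))))

        -- The situation is contradictory: if `l < k` is the value of `perm n c` at `P.inv d k`,
        -- agreement below `k` gives `P.inv d l ≡ P.inv d k`, hence `l ≡ k`.
        not-before : ∀ k → (∀ l → l Fin.< k → P.inv c l ≡ P.inv d l) →
          perm n c (P.inv d k) Fin.< k → P.inv c k ≡ P.inv d k
        not-before k ih l<k = contradiction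
          (cong toℕ (P.inv-injective d _ _ (trans (sym (ih _ l<k)) (P.inv∘f c (P.inv d k)))))
          (ℕ.<⇒≢ l<k)

    -- Each Lehmer code is sent to its ranking, tagged by its word of levels; there are at most
    -- `D ^ n` tags. Ranking and word recover the inverse permutation value by value.
    n!≤count*D^n : n ! ≤ count * D ^ n
    n!≤count*D^n = ≤-count* R.rank word extensional linear λ c d ranks words →
      perm-code-injective n c d λ a →
        trans (sym (P.f∘inv d (perm n c a)))
          (cong (perm n d) (trans (sym (agree c d ranks words (perm n c a))) (P.inv∘f c a)))
      where
      extensional : ∀ {S T : Fin n → Fin n} → S ≗ T →
        Injective′ S × (∀ a b → a ≺ b → S a Fin.< S b) →
        Injective′ T × (∀ a b → a ≺ b → T a Fin.< T b)
      extensional S≗T (inj , mono) =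
        (λ a b eq → inj a b (trans (S≗T a) (trans eq (sym (S≗T b)))))
        , λ a b a≺b → subst₂ Fin._<_ (S≗T a) (S≗T b) (mono a b a≺b)
      agree : ∀ c d → R.rank c ≗ R.rank d → word c ≡ word d → ∀ k → P.inv c k ≡ P.inv d k
      agree c d ranks words = Fin-strong-induction _ step
        where
        step : ∀ k → (∀ l → l Fin.< k → P.inv c l ≡ P.inv d l) → P.inv c k ≡ P.inv d k
        step k ih with ℕ.<-cmp (toℕ (perm n c (P.inv d k))) (toℕ k) | ℕ.<-cmp (toℕ (perm n d (P.inv c k))) (toℕ k)
        ... | tri< p _ _ | _ = not-before c d ranks words k ih p
        ... | tri≈ _ p _ | _ = trans (cong (P.inv c) (sym (Fin.toℕ-injective p))) (P.inv∘f c _)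
        ... | tri> _ _ p | tri< q _ _ = sym (not-before d c (sym ∘ ranks) (sym words) k (λ l l<k → sym (ih l l<k)) q)
        ... | tri> _ _ p | tri≈ _ q _ = sym (trans (cong (P.inv d) (sym (Fin.toℕ-injective q))) (P.inv∘f d _))
        -- Equal words put `P.inv c k` and `P.inv d k` on one level. The first precedes the second
        -- under `c`, hence by `transfer` under `d`, where the second has value `k`; but `q` puts
        -- the first above `k`.
        ... | tri> _ _ p | tri> _ _ q = contradiction q (ℕ.<-asym
          (subst (toℕ (perm n d (P.inv c k)) <_) (cong toℕ (P.f∘inv d k))
            (transfer c d ranks words (funToFin-injective _ _ words k)
              (subst (λ x → toℕ x < toℕ (perm n c (P.inv d k))) (sym (P.f∘inv c k)) p))))

-- Partitions and the monotonicity of hook lengths.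

nth-suc≤ : ∀ {xs} → Linked _≥_ xs → ∀ i → nth xs (suc i) ≤ nth xs i
nth-suc≤ []        i       = z≤n
nth-suc≤ [-]       i       = z≤n
nth-suc≤ (x≥y ∷ _) zero    = x≥y
nth-suc≤ (_ ∷ l)   (suc i) = nth-suc≤ l i

nth-antitone : ∀ {xs} → Linked _≥_ xs → ∀ {i i′} → i ≤ i′ → nth xs i′ ≤ nth xs i
nth-antitone {xs} l i≤i′ = go (ℕ.≤⇒≤′ i≤i′)
  where
  go : ∀ {i i′} → i ℕ.≤′ i′ → nth xs i′ ≤ nth xs i
  go ℕ.≤′-refl     = ℕ.≤-refl
  go (ℕ.≤′-step p) = ℕ.≤-trans (nth-suc≤ l _) (go p)

-- In a decreasing list every entry up to index `i` is at least `nth xs i`, so the filter keeps at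
-- least `suc i` entries.
j<nth⇒i<length-filter : ∀ {xs} → Linked _≥_ xs → ∀ i j → j < nth xs i → i < length (filter (j ℕ.<?_) xs)
j<nth⇒i<length-filter {x ∷ xs} l i j j<nth
  rewrite filter-accept (j ℕ.<?_) {x} {xs} (ℕ.<-≤-trans j<nth (nth-antitone l {0} {i} z≤n)) with i
... | zero  = s≤s z≤n
... | suc i = s≤s (j<nth⇒i<length-filter (Linked.tail l) i j j<nth)

row-antitone : ∀ p {i i′} → i ≤ i′ → row p i′ ≤ row p i
row-antitone p = nth-antitone (decreasing p)

col-antitone : ∀ p {j j′} → j ≤ j′ → col p j′ ≤ col p j
col-antitone p {j} {j′} j≤j′ =
  length-filter-mono (j′ ℕ.<?_) (j ℕ.<?_) (λ x → ℕ.≤-<-trans j≤j′) (parts p)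

j<row⇒i<col : ∀ p i j → j < row p i → i < col p j
j<row⇒i<col p = j<nth⇒i<length-filter (decreasing p)

-- `n` may exceed `m`, which covers a hook length truncated to zero at the second cell.
∸-monoʳ-<′ : ∀ {m n o} → o < n → o < m → m ∸ n < m ∸ o
∸-monoʳ-<′ {suc m} {suc n} {zero}  _         _         = s≤s (ℕ.m∸n≤m m n)
∸-monoʳ-<′ {suc m} {suc n} {suc o} (s≤s o<n) (s≤s o<m) = ∸-monoʳ-<′ o<n o<m

-- Going east or south, the row and column lengths do not grow, while the subtracted sum of
-- coordinates increases strictly.
hook-strict : ∀ p u v → proj₂ u < row p (proj₁ u) → u ◁ v → hook p v < hook p u
hook-strict p (i , j) (i′ , j′) j<row u◁v = begin-strict
  (row p i′ + col p j′) ∸ (i′ + j′ + 1)    ≤⟨ ℕ.∸-monoˡ-≤ (i′ + j′ + 1) (ends u◁v) ⟩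
  (row p i + col p j) ∸ (i′ + j′ + 1)      <⟨ ∸-monoʳ-<′ (offsets u◁v) room ⟩
  (row p i + col p j) ∸ (i + j + 1)        ∎
  where
  open ℕ.≤-Reasoning
  ends : (i , j) ◁ (i′ , j′) → row p i′ + col p j′ ≤ row p i + col p j
  ends (inj₁ (refl , j<j′)) = ℕ.+-monoʳ-≤ (row p i) (col-antitone p (ℕ.<⇒≤ j<j′))
  ends (inj₂ (refl , i<i′)) = ℕ.+-monoˡ-≤ (col p j) (row-antitone p (ℕ.<⇒≤ i<i′))

  offsets : (i , j) ◁ (i′ , j′) → i + j + 1 < i′ + j′ + 1
  offsets (inj₁ (refl , j<j′)) = ℕ.+-monoˡ-< 1 (ℕ.+-monoʳ-< i j<j′)
  offsets (inj₂ (refl , i<i′)) = ℕ.+-monoˡ-< 1 (ℕ.+-monoˡ-< j i<i′)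
  -- The hook length at `u` is positive, so truncation cannot make both sides zero.
  room : i + j + 1 < row p i + col p j
  room = begin-strict
    i + j + 1                ≡⟨ ℕ.+-assoc i j 1 ⟩
    i + (j + 1)              <⟨ ℕ.+-mono-<-≤ (j<row⇒i<col p i j j<row) (ℕ.≤-reflexive (ℕ.+-comm j 1)) ⟩
    col p j + suc j          ≤⟨ ℕ.+-monoʳ-≤ (col p j) j<row ⟩
    col p j + row p i        ≡⟨ ℕ.+-comm (col p j) (row p i) ⟩
    row p i + col p j        ∎

∈⇒≤-foldr-⊔ : ∀ {x xs} → x ∈ xs → x ≤ foldr _⊔_ 0 xs
∈⇒≤-foldr-⊔ {xs = y ∷ ys} (here refl) = ℕ.m≤m⊔n y (foldr _⊔_ 0 ys)
∈⇒≤-foldr-⊔ {xs = y ∷ ys} (there x∈)  = ℕ.≤-trans (∈⇒≤-foldr-⊔ x∈) (ℕ.m≤n⊔m y (foldr _⊔_ 0 ys))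

-- Bounds for the number of standard tableaux of a skew shape.

module _ (ν : SkewShape) where

  private
    λ₁ = row (outer ν) 0
    λ₁′ = col (outer ν) 0

    box : List Cell
    box = cartesianProduct (upTo λ₁′) (upTo λ₁)

    cell : Fin (size ν) → Cell
    cell = lookup (cells ν)

    cell-injective : ∀ a b → cell a ≡ cell b → a ≡ b
    cell-injective = lookup-injective
      (Unique.filter⁺ (_∈ˢ? ν) (Unique.cartesianProduct⁺ (Unique.upTo⁺ λ₁′) (Unique.upTo⁺ λ₁)))

    cell∈ : ∀ a → cell a ∈ box × cell a ∈ˢ ν
    cell∈ a = ∈-filter⁻ (_∈ˢ? ν) {xs = box} (∈-lookup a)

    row< : ∀ a → proj₁ (cell a) < λ₁′
    row< a = ∈-upTo⁻ (proj₁ (∈-cartesianProduct⁻ (upTo λ₁′) (upTo λ₁) (proj₁ (cell∈ a))))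

    col< : ∀ a → proj₂ (cell a) < λ₁
    col< a = ∈-upTo⁻ (proj₂ (∈-cartesianProduct⁻ (upTo λ₁′) (upTo λ₁) (proj₁ (cell∈ a))))

    _≺_ : Fin (size ν) → Fin (size ν) → Set
    a ≺ b = cell a ◁ cell b

    open LinearExtension {_≺_ = _≺_} (isSYT? ν)

    sameRow : ∀ a b → proj₁ (cell a) ≡ proj₁ (cell b) → a ≡ b ⊎ a ≺ b ⊎ b ≺ a
    sameRow a b eq with ℕ.<-cmp (proj₂ (cell a)) (proj₂ (cell b))
    ... | tri< p _ _ = inj₂ (inj₁ (inj₁ (eq , p)))
    ... | tri≈ _ p _ = inj₁ (cell-injective a b (cong₂ _,_ eq p))
    ... | tri> _ _ p = inj₂ (inj₂ (inj₁ (sym eq , p)))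

    sameCol : ∀ a b → proj₂ (cell a) ≡ proj₂ (cell b) → a ≡ b ⊎ a ≺ b ⊎ b ≺ a
    sameCol a b eq with ℕ.<-cmp (proj₁ (cell a)) (proj₁ (cell b))
    ... | tri< p _ _ = inj₂ (inj₁ (inj₂ (eq , p)))
    ... | tri≈ _ p _ = inj₁ (cell-injective a b (cong₂ _,_ p eq))
    ... | tri> _ _ p = inj₂ (inj₂ (inj₂ (sym eq , p)))

    hook≤depth : ∀ a → hook (outer ν) (cell a) ≤ depth ν
    hook≤depth a = ∈⇒≤-foldr-⊔ (∈-map⁺ (hook (outer ν)) (∈-lookup {xs = cells ν} a))

  e≤width^size : e ν ≤ width ν ^ size ν
  e≤width^size with ℕ.⊓-sel λ₁ λ₁′
  -- The chains are the columns when `λ₁` attains the minimum, and the rows when `λ₁′` does.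
  ... | inj₁ eq rewrite eq = count≤w^n (λ a → fromℕ< (col< a))
    (λ a b eq → sameCol a b (Fin.fromℕ<-injective _ _ (col< a) (col< b) eq))
  ... | inj₂ eq rewrite eq = count≤w^n (λ a → fromℕ< (row< a))
    (λ a b eq → sameRow a b (Fin.fromℕ<-injective _ _ (row< a) (row< b) eq))

  -- Levels must increase along `_≺_`, so the level is the depth minus the hook length. It ranges
  -- from 0 to `depth ν`, which accounts for the `suc`.
  size!≤e*depth^size : size ν ! ≤ e ν * suc (depth ν) ^ size ν
  size!≤e*depth^size = n!≤count*D^n (λ a → fromℕ< (codepth< a)) λ a b a≺b →
    subst₂ _<_ (sym (Fin.toℕ-fromℕ< (codepth< a))) (sym (Fin.toℕ-fromℕ< (codepth< b)))
      (ℕ.∸-monoʳ-< (hook-strict (outer ν) (cell a) (cell b) (proj₂ (proj₂ (cell∈ a))) a≺b) (hook≤depth a))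
    where
    codepth< : ∀ a → depth ν ∸ hook (outer ν) (cell a) < suc (depth ν)
    codepth< a = s≤s (ℕ.m∸n≤m (depth ν) (hook (outer ν) (cell a)))

-- Inequalities for powers and factorials.

module _ where
  open ℕ.+-*-Solver

  -- A discrete mean value inequality for the power function, by induction on the exponent.
  [1+n]^[1+k]≤ : ∀ n k → suc n ^ suc k ≤ n ^ suc k + suc k * suc n ^ k
  [1+n]^[1+k]≤ n zero    = ℕ.≤-reflexive
    (solve 1 (λ n → (con 1 :+ n) :* con 1 := n :* con 1 :+ con 1) refl n)
  [1+n]^[1+k]≤ n (suc k) = begin
    suc n * suc n ^ suc k
      ≤⟨ ℕ.*-monoʳ-≤ (suc n) ([1+n]^[1+k]≤ n k) ⟩
    suc n * (n ^ suc k + suc k * suc n ^ k)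
      ≡⟨ solve 4 (λ n p k q → (con 1 :+ n) :* (p :+ k :* q) := (n :* p :+ k :* ((con 1 :+ n) :* q)) :+ p)
           refl n (n ^ suc k) (suc k) (suc n ^ k) ⟩
    (n * n ^ suc k + suc k * suc n ^ suc k) + n ^ suc k
      ≤⟨ ℕ.+-monoʳ-≤ (n * n ^ suc k + suc k * suc n ^ suc k) (ℕ.^-monoˡ-≤ (suc k) (ℕ.n≤1+n n)) ⟩
    (n * n ^ suc k + suc k * suc n ^ suc k) + suc n ^ suc k
      ≡⟨ solve 3 (λ a k q → (a :+ k :* q) :+ q := a :+ (con 1 :+ k) :* q)
           refl (n * n ^ suc k) (suc k) (suc n ^ suc k) ⟩
    n ^ suc (suc k) + suc (suc k) * suc n ^ suc k ∎
    where open ℕ.≤-Reasoning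

  -- Double induction. Divided by the factorial of `suc k`, the two terms of `[1+n]^[1+k]≤` are each
  -- at most half of the target power of 2. The case `k = n` gives n! ≥ (n/4)ⁿ.
  n^k≤k!*2^[n+k] : ∀ n k → n ^ k ≤ k ! * 2 ^ (n + k)
  n^k≤k!*2^[n+k] n       zero    = ℕ.≤-trans (ℕ.m^n>0 2 (n + 0)) (ℕ.m≤m+n _ 0)
  n^k≤k!*2^[n+k] zero    (suc k) = z≤n
  n^k≤k!*2^[n+k] (suc n) (suc k) = begin
    suc n ^ suc k
      ≤⟨ [1+n]^[1+k]≤ n k ⟩
    n ^ suc k + suc k * suc n ^ k
      ≤⟨ ℕ.+-mono-≤ (n^k≤k!*2^[n+k] n (suc k)) (ℕ.*-monoʳ-≤ (suc k) (n^k≤k!*2^[n+k] (suc n) k)) ⟩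
    suc k ! * 2 ^ (n + suc k) + suc k * (k ! * 2 ^ (suc n + k))
      ≡⟨ cong (λ x → suc k ! * 2 ^ (n + suc k) + suc k * (k ! * 2 ^ x)) (sym (ℕ.+-suc n k)) ⟩
    suc k ! * 2 ^ (n + suc k) + suc k * (k ! * 2 ^ (n + suc k))
      ≡⟨ solve 3 (λ k f p → (k :* f) :* p :+ k :* (f :* p) := (k :* f) :* (con 2 :* p))
           refl (suc k) (k !) (2 ^ (n + suc k)) ⟩
    suc k ! * 2 ^ (suc n + suc k) ∎
    where open ℕ.≤-Reasoning

  ^-distribʳ-* : ∀ m n k → (m * n) ^ k ≡ m ^ k * n ^ k
  ^-distribʳ-* m n zero    = refl
  ^-distribʳ-* m n (suc k) = trans (cong (m * n *_) (^-distribʳ-* m n k))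
    (solve 4 (λ m n p q → (m :* n) :* (p :* q) := (m :* p) :* (n :* q)) refl m n (m ^ k) (n ^ k))

  n^n≤n!*4^n : ∀ n → n ^ n ≤ n ! * 4 ^ n
  n^n≤n!*4^n n = subst (λ x → n ^ n ≤ n ! * x)
    (trans (ℕ.^-distribˡ-+-* 2 n n) (sym (^-distribʳ-* 2 2 n))) (n^k≤k!*2^[n+k] n n)

  -- From w ≤ A n / g and A² ≤ g follows w² g ≤ A² n² / g ≤ n². After squaring, one factor g absorbs
  -- the constant A² and another survives. Division is avoided by comparing after multiplication by
  -- g.
  e²g^n≤[n^n]² : ∀ A e w g n .{{_ : NonZero g}} → e ≤ w ^ n → w * g ≤ A * n → A * A ≤ g →
    (e * e) * g ^ n ≤ n ^ n * n ^ n
  e²g^n≤[n^n]² A e w g n e≤w^n wg≤An A²≤g = begin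
    (e * e) * g ^ n            ≤⟨ ℕ.*-monoˡ-≤ (g ^ n) (ℕ.*-mono-≤ e≤w^n e≤w^n) ⟩
    (w ^ n * w ^ n) * g ^ n    ≡⟨ cong (_* g ^ n) (^-distribʳ-* w w n) ⟨
    (w * w) ^ n * g ^ n        ≡⟨ ^-distribʳ-* (w * w) g n ⟨
    (w * w * g) ^ n            ≤⟨ ℕ.^-monoˡ-≤ n (ℕ.*-cancelʳ-≤ (w * w * g) (n * n) g w²g²≤n²g) ⟩
    (n * n) ^ n                ≡⟨ ^-distribʳ-* n n n ⟩
    n ^ n * n ^ n              ∎
    where
    open ℕ.≤-Reasoning
    w²g²≤n²g : w * w * g * g ≤ n * n * g
    w²g²≤n²g = begin
      w * w * g * g      ≡⟨ solve 2 (λ w g → w :* w :* g :* g := (w :* g) :* (w :* g)) refl w g ⟩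
      (w * g) * (w * g)  ≤⟨ ℕ.*-mono-≤ wg≤An wg≤An ⟩
      (A * n) * (A * n)  ≡⟨ solve 2 (λ a n → (a :* n) :* (a :* n) := n :* n :* (a :* a)) refl A n ⟩
      n * n * (A * A)    ≤⟨ ℕ.*-monoʳ-≤ (n * n) A²≤g ⟩
      n * n * g          ∎

  -- One factor g absorbs both the constant B and the 4 lost in bounding the factorial: 4 D ≤ 4 B g
  -- ≤ g².
  n^n≤e[g^n]² : ∀ B e D g n → n ! ≤ e * D ^ n → D ≤ B * g → 4 * B ≤ g →
    n ^ n ≤ e * (g ^ n * g ^ n)
  n^n≤e[g^n]² B e D g n n!≤eD^n D≤Bg 4B≤g = begin
    n ^ n                    ≤⟨ n^n≤n!*4^n n ⟩
    n ! * 4 ^ n              ≤⟨ ℕ.*-monoˡ-≤ (4 ^ n) n!≤eD^n ⟩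
    e * D ^ n * 4 ^ n        ≡⟨ ℕ.*-assoc e (D ^ n) (4 ^ n) ⟩
    e * (D ^ n * 4 ^ n)      ≡⟨ cong (e *_) (^-distribʳ-* D 4 n) ⟨
    e * (D * 4) ^ n          ≤⟨ ℕ.*-monoʳ-≤ e (ℕ.^-monoˡ-≤ n 4D≤g²) ⟩
    e * (g * g) ^ n          ≡⟨ cong (e *_) (^-distribʳ-* g g n) ⟩
    e * (g ^ n * g ^ n)      ∎
    where
    open ℕ.≤-Reasoning
    4D≤g² : D * 4 ≤ g * g
    4D≤g² = begin
      D * 4        ≤⟨ ℕ.*-monoˡ-≤ 4 D≤Bg ⟩
      B * g * 4    ≡⟨ solve 2 (λ b g → b :* g :* con 4 := con 4 :* b :* g) refl B g ⟩
      4 * B * g    ≤⟨ ℕ.*-monoˡ-≤ g 4B≤g ⟩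
      g * g        ∎

-- Natural numbers inside the rationals, and approximate inequalities.

open ℚ.+-*-Solver using (solve; _:+_; _:-_; :-_; _:*_; _:=_; con)

ι-+ : ∀ m n → ι (m + n) ≡ ι m ℚ.+ ι n
ι-+ zero    n = sym (ℚ.+-identityˡ (ι n))
ι-+ (suc m) n = begin
  ι (suc m + n)           ≡⟨ ι-suc (m + n) ⟩
  1ℚ ℚ.+ ι (m + n)        ≡⟨ cong (1ℚ ℚ.+_) (ι-+ m n) ⟩
  1ℚ ℚ.+ (ι m ℚ.+ ι n)    ≡⟨ ℚ.+-assoc 1ℚ (ι m) (ι n) ⟨
  (1ℚ ℚ.+ ι m) ℚ.+ ι n    ≡⟨ cong (ℚ._+ ι n) (ι-suc m) ⟨
  ι (suc m) ℚ.+ ι n       ∎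
  where open ≡-Reasoning

ι-* : ∀ m n → ι (m * n) ≡ ι m ℚ.* ι n
ι-* zero    n = sym (ℚ.*-zeroˡ (ι n))
ι-* (suc m) n = begin
  ι (n + m * n)                ≡⟨ ι-+ n (m * n) ⟩
  ι n ℚ.+ ι (m * n)            ≡⟨ cong (ι n ℚ.+_) (ι-* m n) ⟩
  ι n ℚ.+ ι m ℚ.* ι n          ≡⟨ solve 2 (λ m n → n :+ m :* n := (con 1ℚ :+ m) :* n) refl (ι m) (ι n) ⟩
  (1ℚ ℚ.+ ι m) ℚ.* ι n         ≡⟨ cong (ℚ._* ι n) (ι-suc m) ⟨
  ι (suc m) ℚ.* ι n            ∎
  where open ≡-Reasoning

0≤ι : ∀ n → 0ℚ ℚ.≤ ι n
0≤ι n = ℚ.toℚᵘ-cancel-≤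
  (ℚᵘ.≤-trans (ℚᵘ.nonNegative⁻¹ (ℚᵘ.mkℚᵘ (+ n) 0)) (ℚᵘ.≤-reflexive (ℚᵘ.≃-sym (toℚᵘ-/ n 0))))

ι-cancel-≤ : ∀ {m n} → ι m ℚ.≤ ι n → m ≤ n
ι-cancel-≤ {m} {n} ιm≤ιn = ℤ.drop‿+≤+ (subst₂ ℤ._≤_ (ℤ.*-identityʳ (+ m)) (ℤ.*-identityʳ (+ n))
  (ℚᵘ.drop-*≤* (begin
    ℚᵘ.mkℚᵘ (+ m) 0    ≃⟨ toℚᵘ-/ m 0 ⟨
    ℚ.toℚᵘ (ι m)       ≤⟨ ℚ.toℚᵘ-mono-≤ ιm≤ιn ⟩
    ℚ.toℚᵘ (ι n)       ≃⟨ toℚᵘ-/ n 0 ⟩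
    ℚᵘ.mkℚᵘ (+ n) 0    ∎)))
  where open ℚᵘ.≤-Reasoning

∃-ι-above : ∀ q → ∃ λ A → q ℚ.≤ ι A
∃-ι-above (mkℚ (+ a) d _)      = a , ℚ.toℚᵘ-cancel-≤
  (ℚᵘ.≤-trans (ℚᵘ.*≤* (ℤ.*-monoˡ-≤-nonNeg (+ a) (ℤ.+≤+ (s≤s z≤n)))) (ℚᵘ.≤-reflexive (ℚᵘ.≃-sym (toℚᵘ-/ a 0))))
∃-ι-above (mkℚ ℤ.-[1+ a ] d _) = 0 , ℚ.*≤* ℤ.-≤+

quot*ι : ∀ n g .{{_ : NonZero g}} → quot n g ℚ.* ι g ≡ ι n
quot*ι n (suc d) = ℚ.toℚᵘ-injective (begin
  ℚ.toℚᵘ (quot n (suc d) ℚ.* ι (suc d))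
    ≈⟨ ℚ.toℚᵘ-homo-* (quot n (suc d)) (ι (suc d)) ⟩
  ℚ.toℚᵘ (quot n (suc d)) ℚᵘ.* ℚ.toℚᵘ (ι (suc d))
    ≈⟨ ℚᵘ.*-cong (toℚᵘ-/ n d) (toℚᵘ-/ (suc d) 0) ⟩
  ℚᵘ.mkℚᵘ (+ n) d ℚᵘ.* ℚᵘ.mkℚᵘ (+ suc d) 0
    ≈⟨ ℚᵘ.*≡* (trans (ℤ.*-identityʳ _) (cong (+ n ℤ.*_) (cong +_ (sym (ℕ.*-identityʳ (suc d)))))) ⟩
  ℚᵘ.mkℚᵘ (+ n) 0
    ≈⟨ toℚᵘ-/ n 0 ⟨
  ℚ.toℚᵘ (ι n) ∎)
  where open import Relation.Binary.Reasoning.Setoid ℚᵘ.≃-setoid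

-- Inequality up to an error O(1/k), the rate at which logSum converges.

infix 4 _≲_

record _≲_ (x y : ℕ → ℚ) : Set where
  constructor within
  field
    slope : ℕ
    bound : ∀ k → x k ℚ.≤ y k ℚ.+ ι slope ℚ.* recip k

≤⇒≲ : ∀ {x y} → (∀ k → x k ℚ.≤ y k) → x ≲ y
≤⇒≲ {x} {y} h = within 0 λ k → ℚ.≤-trans (h k)
  (ℚ.≤-reflexive (solve 2 (λ y r → y := y :+ con 0ℚ :* r) refl (y k) (recip k)))

≲-trans : ∀ {x y z} → x ≲ y → y ≲ z → x ≲ z
≲-trans {x} {y} {z} (within c p) (within d q) = within (d + c) λ k → begin
  x k                                                    ≤⟨ p k ⟩
  y k ℚ.+ ι c ℚ.* recip k                                ≤⟨ ℚ.+-monoˡ-≤ (ι c ℚ.* recip k) (q k) ⟩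
  (z k ℚ.+ ι d ℚ.* recip k) ℚ.+ ι c ℚ.* recip k          ≡⟨ solve 4 (λ z d c r →
    (z :+ d :* r) :+ c :* r := z :+ (d :+ c) :* r) refl (z k) (ι d) (ι c) (recip k) ⟩
  z k ℚ.+ (ι d ℚ.+ ι c) ℚ.* recip k                      ≡⟨ cong (λ s → z k ℚ.+ s ℚ.* recip k) (ι-+ d c) ⟨
  z k ℚ.+ ι (d + c) ℚ.* recip k                          ∎
  where open ℚ.≤-Reasoning

≲-refl : ∀ {x} → x ≲ x
≲-refl = ≤⇒≲ λ _ → ℚ.≤-refl

infixl 6 _⊕_
_⊕_ : (ℕ → ℚ) → (ℕ → ℚ) → ℕ → ℚ
(x ⊕ y) k = x k ℚ.+ y k

⊕-mono-≲ : ∀ {x x′ y y′} → x ≲ x′ → y ≲ y′ → x ⊕ y ≲ x′ ⊕ y′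
⊕-mono-≲ {x} {x′} {y} {y′} (within c p) (within d q) = within (c + d) λ k → begin
  x k ℚ.+ y k
    ≤⟨ ℚ.+-mono-≤ (p k) (q k) ⟩
  (x′ k ℚ.+ ι c ℚ.* recip k) ℚ.+ (y′ k ℚ.+ ι d ℚ.* recip k)
    ≡⟨ solve 5 (λ x y c d r → (x :+ c :* r) :+ (y :+ d :* r) := (x :+ y) :+ (c :+ d) :* r)
         refl (x′ k) (y′ k) (ι c) (ι d) (recip k) ⟩
  (x′ k ℚ.+ y′ k) ℚ.+ (ι c ℚ.+ ι d) ℚ.* recip k
    ≡⟨ cong (λ s → (x′ k ℚ.+ y′ k) ℚ.+ s ℚ.* recip k) (ι-+ c d) ⟨
  (x′ k ℚ.+ y′ k) ℚ.+ ι (c + d) ℚ.* recip k ∎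
  where open ℚ.≤-Reasoning

≲⇒eventually : ∀ {x y} → x ≲ y → ∀ ε → 0ℚ ℚ.< ε → ∃ λ N → ∀ k → N ≤ k → x k ℚ.≤ y k ℚ.+ ε
≲⇒eventually {x} {y} (within c p) ε 0<ε =
  let (i , h) = archimedean ε 0<ε
      -- Chosen so that `suc N` is `suc i * suc c`, whence (c + 1) / (N + 1) = 1 / (i + 1). Using
      -- `suc c` covers slope 0.
      N = c + i * suc c
      open ℚ.≤-Reasoning
  in N , λ k N≤k → begin
    x k                                  ≤⟨ p k ⟩
    y k ℚ.+ ι c ℚ.* recip k              ≤⟨ ℚ.+-monoʳ-≤ (y k) (ℚ.*-monoʳ-≤-nonNeg (recip k)
                                              {{ℚ.nonNegative (recip-nonNeg k)}} (ιc≤ι[1+c])) ⟩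
    y k ℚ.+ ι (suc c) ℚ.* recip k        ≤⟨ ℚ.+-monoʳ-≤ (y k) (ℚ.*-monoˡ-≤-nonNeg (ι (suc c))
                                              {{ℚ.nonNegative (0≤ι (suc c))}} (recip-anti N≤k)) ⟩
    y k ℚ.+ ι (suc c) ℚ.* recip N        ≡⟨ cong (y k ℚ.+_) (ι*recip c i) ⟩
    y k ℚ.+ recip i                      ≤⟨ ℚ.+-monoʳ-≤ (y k) h ⟩
    y k ℚ.+ ε                            ∎
  where
  ιc≤ι[1+c] : ι c ℚ.≤ ι (suc c)
  ιc≤ι[1+c] = subst₂ ℚ._≤_ (ℚ.+-identityˡ (ι c)) (sym (ι-suc c)) (ℚ.+-monoˡ-≤ (ι c) (0≤ι 1))

-- Laws of the logarithm up to O(1/k).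

lg : ℕ → ℕ → ℚ
lg m = seq (log m)

H-mono : ∀ {m n} → m ≤ n → H m ℚ.≤ H n
H-mono m≤n = go (ℕ.≤⇒≤′ m≤n)
  where
  go : ∀ {m n} → m ℕ.≤′ n → H m ℚ.≤ H n
  go ℕ.≤′-refl                 = ℚ.≤-refl
  go {n = suc n} (ℕ.≤′-step p) = ℚ.≤-trans (go p)
    (subst (ℚ._≤ H n ℚ.+ recip n) (ℚ.+-identityʳ (H n)) (ℚ.+-monoʳ-≤ (H n) (recip-nonNeg n)))

lg-mono : ∀ {m n} .{{_ : NonZero m}} → m ≤ n → lg m ≲ lg n
lg-mono {suc m} {suc n} m≤n = ≤⇒≲ λ k → ℚ.+-monoˡ-≤ (ℚ.- H (suc k)) (H-mono (ℕ.*-monoˡ-≤ (suc k) m≤n))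

-- log (m n) is log m on the mesh 1/(n K) plus log n on the mesh 1/K.
logSum-* : ∀ m n k →
  logSum (suc m * suc n) k ≡ logSum (suc m) (k + n * suc k) ℚ.+ logSum (suc n) k
logSum-* m n k = trans
  (cong (λ x → H x ℚ.- H (suc k)) (ℕ.*-assoc (suc m) (suc n) (suc k)))
  (solve 3 (λ a b c → a :- c := (a :- b) :+ (b :- c)) refl
    (H (suc m * (suc n * suc k))) (H (suc n * suc k)) (H (suc k)))

p-q≤r⇒p≤q+1*r : ∀ p q r → p ℚ.- q ℚ.≤ r → p ℚ.≤ q ℚ.+ ι 1 ℚ.* r
p-q≤r⇒p≤q+1*r p q r h = subst₂ ℚ._≤_
  (solve 2 (λ p q → q :+ (p :- q) := p) refl p q)
  (cong (q ℚ.+_) (sym (ℚ.*-identityˡ r)))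
  (ℚ.+-monoʳ-≤ q h)

-- By `logSum-*` the two sides differ only in the mesh used for log m, and `logSum-close` bounds the
-- effect of changing the mesh.
lg-*-≲ : ∀ m n .{{_ : NonZero m}} .{{_ : NonZero n}} → lg (m * n) ≲ lg m ⊕ lg n
lg-*-≲ (suc m) (suc n) = within 1 λ k → p-q≤r⇒p≤q+1*r _ _ (recip k) (begin
  logSum (suc m * suc n) k ℚ.- (logSum (suc m) k ℚ.+ logSum (suc n) k)
    ≡⟨ cong (ℚ._- (logSum (suc m) k ℚ.+ logSum (suc n) k)) (logSum-* m n k) ⟩
  (logSum (suc m) (k + n * suc k) ℚ.+ logSum (suc n) k) ℚ.- (logSum (suc m) k ℚ.+ logSum (suc n) k)
    ≡⟨ solve 3 (λ a b c → (a :+ c) :- (b :+ c) := a :- b) refl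
         (logSum (suc m) (k + n * suc k)) (logSum (suc m) k) (logSum (suc n) k) ⟩
  logSum (suc m) (k + n * suc k) ℚ.- logSum (suc m) k
    ≤⟨ logSum-close m k (k + n * suc k) ⟩
  recip k ∎)
  where open ℚ.≤-Reasoning

lg-*-≳ : ∀ m n .{{_ : NonZero m}} .{{_ : NonZero n}} → lg m ⊕ lg n ≲ lg (m * n)
lg-*-≳ (suc m) (suc n) = within 1 λ k → p-q≤r⇒p≤q+1*r _ _ (recip k) (begin
  (logSum (suc m) k ℚ.+ logSum (suc n) k) ℚ.- logSum (suc m * suc n) k
    ≡⟨ cong (λ x → (logSum (suc m) k ℚ.+ logSum (suc n) k) ℚ.- x) (logSum-* m n k) ⟩
  (logSum (suc m) k ℚ.+ logSum (suc n) k) ℚ.- (logSum (suc m) (k + n * suc k) ℚ.+ logSum (suc n) k)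
    ≡⟨ solve 3 (λ a b c → (b :+ c) :- (a :+ c) := b :- a) refl
         (logSum (suc m) (k + n * suc k)) (logSum (suc m) k) (logSum (suc n) k) ⟩
  logSum (suc m) k ℚ.- logSum (suc m) (k + n * suc k)
    ≤⟨ logSum-close m (k + n * suc k) k ⟩
  recip (k + n * suc k)
    ≤⟨ recip-anti (ℕ.m≤m+n k (n * suc k)) ⟩
  recip k ∎)
  where open ℚ.≤-Reasoning

infixr 7 _⊙_
_⊙_ : ℕ → (ℕ → ℚ) → ℕ → ℚ
(n ⊙ x) k = ι n ℚ.* x k

suc-⊙ : ∀ n x k → (suc n ⊙ x) k ≡ (x ⊕ n ⊙ x) k
suc-⊙ n x k = trans (cong (ℚ._* x k) (ι-suc n))
  (solve 2 (λ n x → (con 1ℚ :+ n) :* x := x :+ n :* x) refl (ι n) (x k))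

lg-1 : ∀ k → lg 1 k ≡ 0ℚ
lg-1 k = trans (cong (λ x → H x ℚ.- H (suc k)) (ℕ.*-identityˡ (suc k))) (ℚ.+-inverseʳ (H (suc k)))

lg-^-≲ : ∀ m n .{{_ : NonZero m}} → lg (m ^ n) ≲ n ⊙ lg m
lg-^-≲ m zero    = ≤⇒≲ λ k → ℚ.≤-reflexive (trans (lg-1 k) (sym (ℚ.*-zeroˡ (lg m k))))
lg-^-≲ m (suc n) = ≲-trans (lg-*-≲ m (m ^ n)) (≲-trans (⊕-mono-≲ (≲-refl {lg m}) (lg-^-≲ m n))
  (≤⇒≲ λ k → ℚ.≤-reflexive (sym (suc-⊙ n (lg m) k))))
  where instance _ = ℕ.m^n≢0 m n

lg-^-≳ : ∀ m n .{{_ : NonZero m}} → n ⊙ lg m ≲ lg (m ^ n)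
lg-^-≳ m zero    = ≤⇒≲ λ k → ℚ.≤-reflexive (trans (ℚ.*-zeroˡ (lg m k)) (sym (lg-1 k)))
lg-^-≳ m (suc n) = ≲-trans (≤⇒≲ λ k → ℚ.≤-reflexive (suc-⊙ n (lg m) k))
  (≲-trans (⊕-mono-≲ (≲-refl {lg m}) (lg-^-≳ m n)) (lg-*-≳ m (m ^ n)))
  where instance _ = ℕ.m^n≢0 m n

-- Bounds for the gap between n log n and log e.

≡⇒≤ᵣ : ∀ {x y} → (∀ k → seq x k ≡ seq y k) → x ≤ᵣ y
≡⇒≤ᵣ {x} {y} x≡y ε 0<ε = 0 , λ k _ → begin
  seq x k           ≡⟨ x≡y k ⟩
  seq y k           ≡⟨ ℚ.+-identityʳ (seq y k) ⟨
  seq y k ℚ.+ 0ℚ    ≤⟨ ℚ.+-monoʳ-≤ (seq y k) (ℚ.<⇒≤ 0<ε) ⟩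
  seq y k ℚ.+ ε     ∎
  where open ℚ.≤-Reasoning

-- This gap is the witness for the Θ term: the formula for log e then holds identically, and the
-- content lies in bounding the gap.
defect : ℕ → ℕ → ℝ
defect n e = (+ n / 1) · log n -ᵣ log e

log≃nlogn-defect : ∀ n e → log e ≃ᵣ (+ n / 1) · log n -ᵣ defect n e
log≃nlogn-defect n e = ≡⇒≤ᵣ {log e} {(+ n / 1) · log n -ᵣ defect n e} cancel
  , ≡⇒≤ᵣ {(+ n / 1) · log n -ᵣ defect n e} {log e} (λ k → sym (cancel k))
  where
  cancel : ∀ k → lg e k ≡ (n ⊙ lg n) k ℚ.- ((n ⊙ lg n) k ℚ.- lg e k)
  cancel k = solve 2 (λ x y → x := y :- (y :- x)) refl (lg e k) ((n ⊙ lg n) k)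

½nlogg≤defect : ∀ e g n .{{_ : NonZero e}} .{{_ : NonZero g}} .{{_ : NonZero n}} →
  (e * e) * g ^ n ≤ n ^ n * n ^ n → ½ · (+ n / 1) · log g ≤ᵣ defect n e
½nlogg≤defect e g n bound ε 0<ε =
  -- The logarithms give 2 log e + n log g ≤ 2 n log n; halving turns the error `ε ℚ.+ ε` into `ε`.
  let (N , h) = ≲⇒eventually logs (ε ℚ.+ ε) (ℚ.+-mono-< 0<ε 0<ε)
      open ℚ.≤-Reasoning
  in N , λ k N≤k → let x = (n ⊙ lg g) k ; y = (n ⊙ lg n) k ; z = lg e k in begin
    ½ ℚ.* x
      ≡⟨ solve 2 (λ x z → con ½ :* x := con ½ :* ((z :+ z) :+ x) :- z) refl x z ⟩
    ½ ℚ.* ((z ℚ.+ z) ℚ.+ x) ℚ.- z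
      ≤⟨ ℚ.+-monoˡ-≤ (ℚ.- z) (ℚ.*-monoˡ-≤-nonNeg ½ (h k N≤k)) ⟩
    ½ ℚ.* ((y ℚ.+ y) ℚ.+ (ε ℚ.+ ε)) ℚ.- z
      ≡⟨ solve 3 (λ y z ε → con ½ :* ((y :+ y) :+ (ε :+ ε)) :- z := (y :- z) :+ ε) refl y z ε ⟩
    (y ℚ.- z) ℚ.+ ε ∎
  where
  instance
    _ = ℕ.m*n≢0 e e
    _ = ℕ.m^n≢0 g n
    _ = ℕ.m^n≢0 n n
    _ = ℕ.m*n≢0 (e * e) (g ^ n)
  logs : (lg e ⊕ lg e) ⊕ n ⊙ lg g ≲ n ⊙ lg n ⊕ n ⊙ lg n
  logs = ≲-trans (⊕-mono-≲ (lg-*-≳ e e) (lg-^-≳ g n))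
    (≲-trans (lg-*-≳ (e * e) (g ^ n))
    (≲-trans (lg-mono bound)
    (≲-trans (lg-*-≲ (n ^ n) (n ^ n))
    (⊕-mono-≲ (lg-^-≲ n n) (lg-^-≲ n n)))))

defect≤2nlogg : ∀ e g n .{{_ : NonZero e}} .{{_ : NonZero g}} .{{_ : NonZero n}} →
  n ^ n ≤ e * (g ^ n * g ^ n) → defect n e ≤ᵣ ι 2 · (+ n / 1) · log g
defect≤2nlogg e g n bound ε 0<ε =
  let (N , h) = ≲⇒eventually logs ε 0<ε
      open ℚ.≤-Reasoning
  in N , λ k N≤k → let x = (n ⊙ lg g) k ; y = (n ⊙ lg n) k ; z = lg e k in begin
    y ℚ.- z
      ≤⟨ ℚ.+-monoˡ-≤ (ℚ.- z) (h k N≤k) ⟩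
    ((z ℚ.+ (x ℚ.+ x)) ℚ.+ ε) ℚ.- z
      ≡⟨ solve 3 (λ x z ε → ((z :+ (x :+ x)) :+ ε) :- z := con (ι 2) :* x :+ ε) refl x z ε ⟩
    ι 2 ℚ.* x ℚ.+ ε ∎
  where
  instance
    _ = ℕ.m^n≢0 g n
    _ = ℕ.m^n≢0 n n
    _ = ℕ.m*n≢0 (g ^ n) (g ^ n)
  logs : n ⊙ lg n ≲ lg e ⊕ (n ⊙ lg g ⊕ n ⊙ lg g)
  logs = ≲-trans (lg-^-≳ n n)
    (≲-trans (lg-mono bound)
    (≲-trans (lg-*-≲ e (g ^ n * g ^ n))
    (⊕-mono-≲ (≲-refl {lg e})
      (≲-trans (lg-*-≲ (g ^ n) (g ^ n)) (⊕-mono-≲ (lg-^-≲ g n) (lg-^-≲ g n))))))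

-- Integer inequalities from the Θ hypotheses.

-- Some natural upper bound rather than the least: the numerator if it is nonnegative, and 0
-- otherwise.
ceil : ℚ → ℕ
ceil q = proj₁ (∃-ι-above q)

≤ceil : ∀ q n → q ℚ.* ι n ℚ.≤ ι (ceil q * n)
≤ceil q n = subst (q ℚ.* ι n ℚ.≤_) (sym (ι-* (ceil q) n))
  (ℚ.*-monoʳ-≤-nonNeg (ι n) {{ℚ.nonNegative (0≤ι n)}} (proj₂ (∃-ι-above q)))

-- Taking ε = 1 gives w ≤ C n / g + 1; after multiplication by g the extra term is g ≤ n, whence the
-- `suc`. Both reals are constant sequences, so a single index suffices.
w*g≤A*n : ∀ C w g n .{{_ : NonZero g}} → fromℕ w ≤ᵣ C · fromℚ (quot n g) → g ≤ n →
  w * g ≤ suc (ceil C) * n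
w*g≤A*n C w g n w≤Cn/g g≤n = ℕ.≤-trans (ι-cancel-≤ (begin
  ι (w * g)                                ≡⟨ ι-* w g ⟩
  ι w ℚ.* ι g                              ≤⟨ ℚ.*-monoʳ-≤-nonNeg (ι g) {{ℚ.nonNegative (0≤ι g)}}
                                               (proj₂ at-1 (proj₁ at-1) ℕ.≤-refl) ⟩
  (C ℚ.* quot n g ℚ.+ 1ℚ) ℚ.* ι g          ≡⟨ solve 3 (λ c q g → (c :* q :+ con 1ℚ) :* g := g :+ c :* (q :* g))
                                               refl C (quot n g) (ι g) ⟩
  ι g ℚ.+ C ℚ.* (quot n g ℚ.* ι g)         ≡⟨ cong (λ x → ι g ℚ.+ C ℚ.* x) (quot*ι n g) ⟩
  ι g ℚ.+ C ℚ.* ι n                        ≤⟨ ℚ.+-monoʳ-≤ (ι g) (≤ceil C n) ⟩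
  ι g ℚ.+ ι (ceil C * n)                   ≡⟨ ι-+ g (ceil C * n) ⟨
  ι (g + ceil C * n)                       ∎))
  (ℕ.+-monoˡ-≤ (ceil C * n) g≤n)
  where
  open ℚ.≤-Reasoning
  at-1 = w≤Cn/g 1ℚ (ℚ.positive⁻¹ 1ℚ)

-- The 2 pays for two units, each at most `g`: one from taking ε = 1, one from the `suc`.
1+D≤B*g : ∀ C D g .{{_ : NonZero g}} → fromℕ D ≤ᵣ C · fromℕ g → suc D ≤ (2 + ceil C) * g
1+D≤B*g C D g D≤Cg = begin
  1 + D                      ≤⟨ s≤s (ι-cancel-≤ D≤1+ceil) ⟩
  1 + (1 + ceil C * g)       ≤⟨ ℕ.+-mono-≤ 1≤g (ℕ.+-monoˡ-≤ (ceil C * g) 1≤g) ⟩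
  (2 + ceil C) * g           ∎
  where
  1≤g : 1 ≤ g
  1≤g = ℕ.>-nonZero⁻¹ g
  at-1 = D≤Cg 1ℚ (ℚ.positive⁻¹ 1ℚ)
  D≤1+ceil : ι D ℚ.≤ ι (1 + ceil C * g)
  D≤1+ceil = let open ℚ.≤-Reasoning in begin
    ι D                        ≤⟨ proj₂ at-1 (proj₁ at-1) ℕ.≤-refl ⟩
    C ℚ.* ι g ℚ.+ 1ℚ           ≤⟨ ℚ.+-monoˡ-≤ 1ℚ (≤ceil C g) ⟩
    ι (ceil C * g) ℚ.+ 1ℚ      ≡⟨ ℚ.+-comm (ι (ceil C * g)) 1ℚ ⟩
    1ℚ ℚ.+ ι (ceil C * g)      ≡⟨ ι-+ 1 (ceil C * g) ⟨
    ι (1 + ceil C * g)         ∎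
  open ℕ.≤-Reasoning

-- Assembly of the asymptotic formula.

theorem7p1 : (g : ℕ → ℕ) → SubpolynomialGrowth g →
    (ν : ℕ → SkewShape) →
    (∀ n → 1 ≤ n → Connected (ν n)) →
    (∀ n → 1 ≤ n → size (ν n) ≡ n) →
    SubpolynomialDepth g ν →
    ∃ λ (f : ℕ → ℝ) →
    f ∈Θ (λ n → (+ n / 1) · log (g n)) ×
    (∀ n → 1 ≤ n → log (e (ν n)) ≃ᵣ (+ n / 1) · log n -ᵣ f n)
theorem7p1 g growth ν _ size≡ shape =
  let open SubpolynomialGrowth growth
      open SubpolynomialDepth shape
      (_ , C₁ , _ , _ , N₁ , width≤) = width-Θ
      (_ , C₂ , _ , _ , N₂ , depth≤) = depth-Θ
      A = suc (ceil C₁)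
      B = 2 + ceil C₂
      -- `A * A ≤ g n` is for the upper bound on `e`, `4 * B ≤ g n` for the lower one.
      (N₃ , large) = unbounded (A * A ⊔ 4 * B)
  in (λ n → defect n (e (ν n)))
   -- The constants are ½, from the square of `e` in the upper bound, and 2, from the square of
   -- `g n ^ n` in the lower one. The 1 in the threshold excludes `n = 0`.
   , (½ , ι 2 , ℚ.positive⁻¹ ½ , ℚ.positive⁻¹ (ι 2) , 1 ⊔ N₁ ⊔ N₂ ⊔ N₃ , λ n N≤n →
       let 1⊔N₁⊔N₂≤n = ℕ.m⊔n≤o⇒m≤o (1 ⊔ N₁ ⊔ N₂) N₃ N≤n
           1⊔N₁≤n = ℕ.m⊔n≤o⇒m≤o (1 ⊔ N₁) N₂ 1⊔N₁⊔N₂≤n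
           1≤n = ℕ.m⊔n≤o⇒m≤o 1 N₁ 1⊔N₁≤n
           A²⊔4B≤g = large n (ℕ.m⊔n≤o⇒n≤o (1 ⊔ N₁ ⊔ N₂) N₃ N≤n)
           n!≤ = subst (λ s → s ! ≤ e (ν n) * suc (depth (ν n)) ^ s) (size≡ n 1≤n) (size!≤e*depth^size (ν n))
           instance
             n≢0 = ℕ.>-nonZero 1≤n
             g≢0 = ℕ.>-nonZero (proj₁ (bounds n 1≤n))
             -- Since n! is positive, the lower bound shows that some tableau exists, so `log` is
             -- not taken at its placeholder value.
             e≢0 = ℕ.m*n≢0⇒m≢0 (e (ν n)) {{ℕ.>-nonZero (ℕ.≤-trans (ℕ.>-nonZero⁻¹ (n !) {{ℕ._!≢0 n}}) n!≤)}}
       in ½nlogg≤defect (e (ν n)) (g n) n (e²g^n≤[n^n]² A (e (ν n)) (width (ν n)) (g n) n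
            (subst (λ s → e (ν n) ≤ width (ν n) ^ s) (size≡ n 1≤n) (e≤width^size (ν n)))
            (w*g≤A*n C₁ (width (ν n)) (g n) n (proj₂ (width≤ n (ℕ.m⊔n≤o⇒n≤o 1 N₁ 1⊔N₁≤n))) (proj₂ (bounds n 1≤n)))
            (ℕ.m⊔n≤o⇒m≤o (A * A) (4 * B) A²⊔4B≤g))
        , defect≤2nlogg (e (ν n)) (g n) n (n^n≤e[g^n]² B (e (ν n)) (suc (depth (ν n))) (g n) n n!≤
            (1+D≤B*g C₂ (depth (ν n)) (g n) (proj₂ (depth≤ n (ℕ.m⊔n≤o⇒n≤o (1 ⊔ N₁) N₂ 1⊔N₁⊔N₂≤n))))
            (ℕ.m⊔n≤o⇒n≤o (A * A) (4 * B) A²⊔4B≤g)))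
   , λ n _ → log≃nlogn-defect n (e (ν n))
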